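{- A process $p$ is a parallel pushdown process if and only if there are a finite data set $\mathcal{D}$ and a regular process $q$ such that $p$ is divergence-preserving branching bisimilar to $$\tau_{\{i,o\}}\bigl(\partial_{\{i,o\}}(q\parallel \mathit{ABag}^{io})\bigr),$$ where $\mathit{ABag}^{io}$ is the always accepting bag over $\mathcal{D}$ with input port $i$ and output port $o$.
   Context: **Labelled transition systems, process graphs, processes.** A labelled transition system is a tuple $(\mathcal{S},\mathcal{A},\rightarrow,\downarrow)$ with $\mathcal{S}$ a set of states, $\mathcal{A}$ a set of actions, $\tau\notin\mathcal{A}$ the silent action, $\rightarrow\,\subseteq\mathcal{S}\times(\mathcal{A}\cup\{\tau\})\times\mathcal{S}$, and $\downarrow\,\subseteq\mathcal{S}$ the accepting states. A process graph is a labelled transition system with a designated root state. Write $s\Rightarrow t$ if $t$ can be reached from $s$ by zero or more $\tau$-transitions, $s\Rightarrow^{+}t$ if by one or more, and $s\xrightarrow{(a)}t$ if $s\xrightarrow{a}t$, or $a=\tau$ and $s=t$. A symmetric relation $R$ on $\mathcal{S}$ is a branching bisimulation if for all $s\mathrel{R}t$ and $a\in\mathcal{A}\cup\{\tau\}$: (1) if $s\xrightarrow{a}s'$ then there are $t'',t'$ with $t\Rightarrow t''\xrightarrow{(a)}t'$, $s\mathrel{R}t''$ and $s'\mathrel{R}t'$; (2) if $s\downarrow$ then there is $t'$ with $t\Rightarrow t'$ and $t'\downarrow$. It is divergence-preserving if for all $s,t$, whenever there is an infinite sequence $s=s_0\xrightarrow{\tau}s_1\xrightarrow{\tau}\cdots$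 with $s_k\mathrel{R}t$ for all $k\geq 0$, there is $t'$ with $t\Rightarrow^{+}t'$ and $s_k\mathrel{R}t'$ for some $k\geq 0$. States are divergence-preserving branching bisimilar if some divergence-preserving branching bisimulation relates them; process graphs are if their roots are, in the disjoint union of the underlying systems. A process is an equivalence class of process graphs under this relation (and is also denoted by any process graph representing it). A regular process is one given by a finite automaton, i.e. a process graph with finitely many states and transitions. A parallel pushdown process is the process of $\mathcal{P}(M)$ for some parallel pushdown automaton $M$. **Parallel pushdown automata.** $\mathcal{D}^{\{\!\{\,\}\!\}}$ is the set of finite multisets (bags) over $\mathcal{D}$, $\cup$ on bags is multiset sum, and $\mathcal{D}^{\pm}=\{+d\mid d\in\mathcal{D}\}\cup\{ -d\mid d\in\mathcal{D}\}$ (two disjoint copies of $\mathcal{D}$). A parallel pushdown automaton is a tuple $M=(\mathcal{S},\mathcal{A},\mathcal{D},\rightarrow,\uparrow,\downarrow)$ with $\mathcal{S}$ a finite set of states, $\mathcal{A}$ a finite input alphabet ($\tau\notin\mathcal{A}$), $\mathcal{D}$ a finite data alphabet, $\rightarrow\,\subseteq\mathcal{S}\times(\mathcal{A}\cup\{\tau\})\times\mathcal{D}^{\pm}\times\mathcal{D}^{\{\!\{\,\}\!\}}\times\mathcal{S}$ a finite set of transitions, $\uparrow\,\in\mathcal{S}$ the initial state, and $\downarrow\,\subseteq\mathcal{S}$ the accepting states. Write $s\xrightarrow{a[+d/x]}t$ for $(s,a,+d,x,t)\in\,\rightarrow$, and $s\xrightarrow{a[-d/x]}t$ for $(s,a,-d,x,t)\in\,\rightarrow$.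 The process graph $\mathcal{P}(M)$ has states $(s,x)$ with $s\in\mathcal{S}$, $x\in\mathcal{D}^{\{\!\{\,\}\!\}}$; root $(\uparrow,\emptyset)$; accepting states all $(s,x)$ with $s\in\,\downarrow$; and exactly the transitions $(s,\{\!\{d\}\!\}\cup x)\xrightarrow{a}(s',x'\cup x)$ whenever $s\xrightarrow{a[+d/x']}s'$, and $(s,x)\xrightarrow{a}(s',x'\cup x)$ whenever there is $d\notin x$ with $s\xrightarrow{a[-d/x']}s'$. **Operators.** $i,o$ are two distinct communication ports reserved for the internal communication (they do not occur in actions of $p$). Communicated values $v$ range over a finite set: elements $d\in\mathcal{D}$ on port $i$, and elements ${}^{+}d$, ${}^{ - }d$ ($d\in\mathcal{D}$) on port $o$. For a port $c$ and value $v$ there are a send action $c!v$, a receive action $c?v$ and a communication action $c(v)$; for a set $C$ of ports, $\mathit{COM}_C$ is the set of all $c!v$, $c?v$ with $c\in C$. The priority ordering $<$ is a strict partial ordering on actions in which $\tau$ is below nothing and $a<b$ implies $a<\tau$ for every action $a\neq\tau$; it satisfies $o!({}^{ - }d)<o!({}^{+}d)$ for every $d\in\mathcal{D}$, and (apart from the implied $o!({}^{ - }d)<\tau$) no other relations are needed. The operational rules are: $\mathbf{1}\downarrow$; $a.p\xrightarrow{a}p$; $p+q$ has all transitions of $p$ and of $q$ and accepts if $p$ or $q$ does; $(p\parallel q)\downarrow$ if $p\downarrow$ and $q\downarrow$; if $p\xrightarrow{a}p'$ then $p\parallel q\xrightarrow{a}p'\parallel q$ and $q\parallel p\xrightarrow{a}q\parallel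 p'$; if $p\xrightarrow{c!v}p'$ and $q\xrightarrow{c?v}q'$ then $p\parallel q\xrightarrow{c(v)}p'\parallel q'$ and $q\parallel p\xrightarrow{c(v)}q'\parallel p'$; if $p\downarrow$ then $\theta(p)\downarrow$, $\partial_C(p)\downarrow$, $\tau_C(p)\downarrow$; if $p\xrightarrow{a}p'$ and for all $b>a$ there is no $p''$ with $p\xrightarrow{b}p''$, then $\theta(p)\xrightarrow{a}\theta(p')$; if $p\xrightarrow{a}p'$ and $a\notin\mathit{COM}_C$ then $\partial_C(p)\xrightarrow{a}\partial_C(p')$; if $p\xrightarrow{c(v)}p'$ with $c\in C$ then $\tau_C(p)\xrightarrow{\tau}\tau_C(p')$; if $p\xrightarrow{a}p'$ and $a$ is not of the form $c(v)$ with $c\in C$ then $\tau_C(p)\xrightarrow{a}\tau_C(p')$; an identifier $X$ with defining equation $X\stackrel{\mathrm{def}}{=}p$ has the transitions and acceptance of $p$. These operators are applied to process graphs via the same rules. **The always accepting bag.** $\mathit{ABag}^{io}$ is defined by $$\mathit{ABag}^{io}\stackrel{\mathrm{def}}{=}\mathbf{1}+\sum_{d\in\mathcal{D}}i?d.\theta\bigl(\mathit{ABag}^{io}\parallel(\mathbf{1}+o!({}^{+}d).\mathbf{1})\bigr)+\sum_{d\in\mathcal{D}}o!({}^{ - }d).\mathit{ABag}^{io}.$$ -}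

module Defs where

open import Level using (0ℓ)
open import Data.Empty using (⊥)
open import Data.Fin using (Fin)
open import Data.List using (List)
open import Data.List.Membership.Propositional using (_∈_)
open import Data.Nat using (ℕ; suc; _+_)
open import Data.Product using (Σ; ∃; ∃-syntax; _×_; _,_)
open import Data.Sum using (_⊎_; inj₁; inj₂; [_,_])
open import Data.Sum.Relation.Binary.Pointwise using (Pointwise)
open import Data.Unit using (⊤)
open import Data.Vec using (Vec; replicate; zipWith; lookup; _[_]≔_)
open import Relation.Binary.Core using (Rel)
open import Relation.Binary.Definitions using (Symmetric)
open import Relation.Binary.Construct.Closure.ReflexiveTransitive using (Star)
open import Relation.Binary.Construct.Closure.Transitive using (TransClosure)
open import Relation.Binary.PropositionalEquality using (_≡_; refl)
open import Relation.Nullary using (¬_)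
open import Relation.Unary using (Pred; U)

-- Under excluded middle, a list containing every element of P can be pruned
-- to one that contains exactly the elements of P.
Finite : {X : Set} → Pred X 0ℓ → Set
Finite P = ∃[ xs ] (∀ {x} → P x → x ∈ xs)

data Label (A : Set) : Set where
  τ   : Label A
  act : A → Label A

record LTS (A : Set) : Set₁ where
  infix 4 _—[_]→_ _—[⦅_⦆]→_ _⇒_ _⇒⁺_
  field
    State   : Set
    _—[_]→_ : State → Label A → State → Set
    _↓      : Pred State 0ℓ

  _—τ→_ : Rel State 0ℓ
  s —τ→ t = s —[ τ ]→ t

  _⇒_ : Rel State 0ℓ
  _⇒_ = Star _—τ→_

  _⇒⁺_ : Rel State 0ℓ
  _⇒⁺_ = TransClosure _—τ→_

  _—[⦅_⦆]→_ : State → Label A → State → Set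
  s —[⦅ a ⦆]→ t = (s —[ a ]→ t) ⊎ (a ≡ τ × s ≡ t)

record ProcessGraph (A : Set) : Set₁ where
  field
    lts  : LTS A
    root : LTS.State lts
  open LTS lts public

module _ {A : Set} (L : LTS A) where
  open LTS L

  record IsBranchingBisimulation (R : Rel State 0ℓ) : Set where
    field
      symmetric : Symmetric R
      transfer  : ∀ {s t a s′} → R s t → s —[ a ]→ s′ →
                  ∃[ t″ ] ∃[ t′ ] (t ⇒ t″ × t″ —[⦅ a ⦆]→ t′ × R s t″ × R s′ t′)
      accept    : ∀ {s t} → R s t → s ↓ → ∃[ t′ ] (t ⇒ t′ × t′ ↓)

  DivergencePreserving : Rel State 0ℓ → Set
  DivergencePreserving R =
    ∀ (s : ℕ → State) {t} →
    (∀ k → s k —[ τ ]→ s (suc k)) → (∀ k → R (s k) t) →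
    ∃[ t′ ] (t ⇒⁺ t′ × ∃[ k ] R (s k) t′)

  DPBranchingBisimilar : State → State → Set₁
  DPBranchingBisimilar s t =
    Σ (Rel State 0ℓ) λ R →
      IsBranchingBisimulation R × DivergencePreserving R × R s t

_⊎ᴸ_ : {A : Set} → LTS A → LTS A → LTS A
L ⊎ᴸ M = record
  { State   = L.State ⊎ M.State
  ; _—[_]→_ = λ s a t → Pointwise (L._—[ a ]→_) (M._—[ a ]→_) s t
  ; _↓      = [ L._↓ , M._↓ ]
  }
  where
  module L = LTS L
  module M = LTS M

infix 4 _≈_

_≈_ : {A : Set} → ProcessGraph A → ProcessGraph A → Set₁
G ≈ H = DPBranchingBisimilar (G.lts ⊎ᴸ H.lts) (inj₁ G.root) (inj₂ H.root)
  where
  module G = ProcessGraph G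
  module H = ProcessGraph H

record IsFiniteAutomaton {A : Set} (G : ProcessGraph A) : Set where
  open ProcessGraph G
  field
    finite-states      : Finite {State} U
    finite-transitions : Finite {State × Label A × State} λ (s , a , t) → s —[ a ]→ t

Regular : {A : Set} → ProcessGraph A → Set₁
Regular {A} q = Σ (ProcessGraph A) λ F → IsFiniteAutomaton F × q ≈ F

-- A bag over Fin n is its vector of multiplicities, so that propositional
-- equality of bags is equality of multisets.
module Bag where

  infixr 6 _∪_

  Bag : ℕ → Set
  Bag n = Vec ℕ n

  ∅ : ∀ {n} → Bag n
  ∅ {n} = replicate n 0

  ⁅_⁆ : ∀ {n} → Fin n → Bag n
  ⁅ d ⁆ = ∅ [ d ]≔ 1

  _∪_ : ∀ {n} → Bag n → Bag n → Bag n
  _∪_ = zipWith _+_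

  _∉ᴮ_ : ∀ {n} → Fin n → Bag n → Set
  d ∉ᴮ x = lookup x d ≡ 0

open Bag

data Signed (D : Set) : Set where
  ⁺_ ⁻_ : D → Signed D

-- The data alphabet is Fin #data.
record ParallelPushdownAutomaton (A : Set) : Set₁ where
  field
    State    : Set
    alphabet : Pred A 0ℓ
    #data    : ℕ

  D : Set
  D = Fin #data

  field
    transition : Pred (State × Label A × Signed D × Bag #data × State) 0ℓ
    initial    : State
    accepting  : Pred State 0ℓ

    finite-states      : Finite {State} U
    finite-alphabet    : Finite alphabet
    finite-transitions : Finite transition
    labels             : ∀ {s a δ x t} → transition (s , act a , δ , x , t) → alphabet a

module _ {A : Set} (M : ParallelPushdownAutomaton A) where
  open ParallelPushdownAutomaton M

  data Step : State × Bag #data → Label A → State × Bag #data → Set where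
    present : ∀ {s a d x′ s′} x → transition (s , a , ⁺ d , x′ , s′) →
              Step (s , ⁅ d ⁆ ∪ x) a (s′ , x′ ∪ x)
    absent  : ∀ {s a d x′ s′} x → d ∉ᴮ x → transition (s , a , ⁻ d , x′ , s′) →
              Step (s , x) a (s′ , x′ ∪ x)

  𝓟 : ProcessGraph A
  𝓟 = record
    { lts  = record
      { State   = State × Bag #data
      ; _—[_]→_ = Step
      ; _↓      = λ (s , _) → accepting s
      }
    ; root = initial , ∅
    }

IsParallelPushdownProcess : {A : Set} → ProcessGraph A → Set₁
IsParallelPushdownProcess {A} p = Σ (ParallelPushdownAutomaton A) λ M → p ≈ 𝓟 M

data Port : Set where
  i o : Port

Value : Set → Port → Set
Value D i = D
Value D o = Signed D

-- `ext a` are the actions that do not involve the ports i and o.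
data Action (A D : Set) : Set where
  ext           : A → Action A D
  _!_ _⁇_ _⟪_⟫ : (c : Port) → Value D c → Action A D

infix 8 _!_ _⁇_

data Extend {A D : Set} : Label A → Label (Action A D) → Set where
  τ   : Extend τ τ
  act : ∀ {a} → Extend (act a) (act (ext a))

extend : {A : Set} (D : Set) → ProcessGraph A → ProcessGraph (Action A D)
extend D G = record
  { lts  = record
    { State   = State
    ; _—[_]→_ = λ s b t → ∃[ a ] (Extend a b × s —[ a ]→ t)
    ; _↓      = _↓
    }
  ; root = root
  }
  where open ProcessGraph G

data _≺_ {A D : Set} : Label (Action A D) → Label (Action A D) → Set where
  absent≺present : ∀ {d} → act (o ! (⁻ d)) ≺ act (o ! (⁺ d))
  absent≺τ       : ∀ {d} → act (o ! (⁻ d)) ≺ τ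

data COM {A D : Set} (C : List Port) : Label (Action A D) → Set where
  send    : ∀ {c v} → c ∈ C → COM C (act (c ! v))
  receive : ∀ {c v} → c ∈ C → COM C (act (c ⁇ v))

data Communication {A D : Set} (C : List Port) : Label (Action A D) → Set where
  comm : ∀ {c v} → c ∈ C → Communication C (act (c ⟪ v ⟫))

-- Process expressions over the data set Fin n; the states of a given
-- transition system L occur in them as constants.
module Process {A : Set} {n : ℕ} (L : LTS (Action A (Fin n))) where

  private
    module L = LTS L

    D : Set
    D = Fin n

  Act : Set
  Act = Label (Action A D)

  infixr 7 _·_
  infixr 6 _∥_
  infixl 5 _⊕_

  data Term : Set where
    state : L.State → Term
    𝟏     : Term
    _·_   : Act → Term → Term
    _⊕_   : Term → Term → Term
    ∑     : (D → Term) → Term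
    _∥_   : Term → Term → Term
    θ     : Term → Term
    ∂⟨_⟩ τ⟨_⟩ : List Port → Term → Term
    ABag  : Term

  ABagBody : Term
  ABagBody =
    𝟏 ⊕ ∑ (λ d → act (i ⁇ d) · θ (ABag ∥ (𝟏 ⊕ act (o ! (⁺ d)) · 𝟏)))
      ⊕ ∑ (λ d → act (o ! (⁻ d)) · ABag)

  -- The transitions of a fixed term.
  Transitions : Set₁
  Transitions = Act → Term → Set

  data Constant (s : L.State) : Transitions where
    constant : ∀ {a s′} → s L.—[ a ]→ s′ → Constant s a (state s′)

  data Prefix (a : Act) (p : Term) : Transitions where
    prefix : Prefix a p a p

  data Choice (P Q : Transitions) : Transitions where
    left  : ∀ {a p′} → P a p′ → Choice P Q a p′
    right : ∀ {a q′} → Q a q′ → Choice P Q a q′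

  data Sum (P : D → Transitions) : Transitions where
    summand : ∀ {a p′} d → P d a p′ → Sum P a p′

  data Parallel (p q : Term) (P Q : Transitions) : Transitions where
    left  : ∀ {a p′} → P a p′ → Parallel p q P Q a (p′ ∥ q)
    right : ∀ {a q′} → Q a q′ → Parallel p q P Q a (p ∥ q′)
    syncˡ : ∀ {c v p′ q′} → P (act (c ! v)) p′ → Q (act (c ⁇ v)) q′ →
            Parallel p q P Q (act (c ⟪ v ⟫)) (p′ ∥ q′)
    syncʳ : ∀ {c v p′ q′} → P (act (c ⁇ v)) p′ → Q (act (c ! v)) q′ →
            Parallel p q P Q (act (c ⟪ v ⟫)) (p′ ∥ q′)

  data Priority (P : Transitions) : Transitions where
    priority : ∀ {a p′} → P a p′ → (∀ b → a ≺ b → ¬ (∃[ p″ ] P b p″)) →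
               Priority P a (θ p′)

  data Encapsulation (C : List Port) (P : Transitions) : Transitions where
    encapsulate : ∀ {a p′} → P a p′ → ¬ COM C a → Encapsulation C P a (∂⟨ C ⟩ p′)

  data Abstraction (C : List Port) (P : Transitions) : Transitions where
    hide : ∀ {c v p′} → c ∈ C → P (act (c ⟪ v ⟫)) p′ → Abstraction C P τ (τ⟨ C ⟩ p′)
    keep : ∀ {a p′} → P a p′ → ¬ Communication C a → Abstraction C P a (τ⟨ C ⟩ p′)

  -- The negative premise of θ rules out a single inductive definition of the
  -- transition relation.  Instead it is computed by recursion on terms, given
  -- the transitions T of ABag.  As ABag is guarded in ABagBody, the
  -- transitions of ABagBody do not depend on T; see ABag-transitions.
  transitions : Transitions → Term → Transitions
  transitions T (state s)  = Constant s
  transitions T 𝟏          = λ _ _ → ⊥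
  transitions T (a · p)    = Prefix a p
  transitions T (p ⊕ q)    = Choice (transitions T p) (transitions T q)
  transitions T (∑ p)      = Sum λ d → transitions T (p d)
  transitions T (p ∥ q)    = Parallel p q (transitions T p) (transitions T q)
  transitions T (θ p)      = Priority (transitions T p)
  transitions T (∂⟨ C ⟩ p) = Encapsulation C (transitions T p)
  transitions T (τ⟨ C ⟩ p) = Abstraction C (transitions T p)
  transitions T ABag       = T

  accepts : Set → Term → Set
  accepts B (state s)  = s L.↓
  accepts B 𝟏          = ⊤
  accepts B (a · p)    = ⊥
  accepts B (p ⊕ q)    = accepts B p ⊎ accepts B q
  accepts B (∑ p)      = ∃[ d ] accepts B (p d)
  accepts B (p ∥ q)    = accepts B p × accepts B q
  accepts B (θ p)      = accepts B p
  accepts B (∂⟨ C ⟩ p) = accepts B p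
  accepts B (τ⟨ C ⟩ p) = accepts B p
  accepts B ABag       = B

  terms : LTS (Action A D)
  terms = record
    { State   = Term
    ; _—[_]→_ = transitions (transitions (λ _ _ → ⊥) ABagBody)
    ; _↓      = accepts (accepts ⊥ ABagBody)
    }

  open LTS terms using (_—[_]→_; _↓)

  ABag-transitions : ∀ {a p} → (ABag —[ a ]→ p) ≡ (ABagBody —[ a ]→ p)
  ABag-transitions = refl

  ABag-accepts : (ABag ↓) ≡ (ABagBody ↓)
  ABag-accepts = refl

  ⟦_⟧ : Term → ProcessGraph (Action A D)
  ⟦ p ⟧ = record { lts = terms ; root = p }

-- τ_{i,o}(∂_{i,o}(q ∥ ABag^io))
_withABag : {A : Set} {n : ℕ} →
            ProcessGraph (Action A (Fin n)) → ProcessGraph (Action A (Fin n))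
q withABag = ⟦ τ⟨ io ⟩ (∂⟨ io ⟩ (state root ∥ ABag)) ⟧
  where
  open ProcessGraph q using (lts; root)
  open Process lts
  open import Data.List using (_∷_; [])

  io : List Port
  io = i ∷ o ∷ []

{-# OPTIONS --safe #-}
module Submission where

-- Divergence-preserving branching bisimilarity of two graphs is recast as a
-- relation between their states satisfying a condition on infinite τ-paths that
-- is closed under relational composition; this yields transitivity.  The
-- process τ(∂(q ∥ ABag)) is strongly bisimilar to q running on a multiset.  If
-- q is finite this is a parallel pushdown process up to renaming.  Conversely,
-- a parallel pushdown automaton is simulated by a finite control which keeps
-- one copy of each datum that is present in its own state: it knows which
-- transitions are enabled without touching the bag, and the communications
-- that restore this invariant after a transition are inert and terminate.

open import Level using (0ℓ)
open import Axiom.ExcludedMiddle using (ExcludedMiddle)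
open import Data.Empty using (⊥-elim)
open import Data.Fin using (Fin; zero; suc; _≟_; toℕ; fromℕ<)
open import Data.Fin.Properties using (all?; ¬∀⟶∃¬; toℕ-fromℕ<; toℕ<n)
open import Data.List
  using (List; []; _∷_; map; _++_; concatMap; allFin; cartesianProduct; cartesianProductWith)
open import Data.List.Membership.Propositional using (_∈_; lose)
open import Data.List.Membership.Propositional.Properties
  using (∈-map⁺; ∈-concatMap⁺; ∈-++⁺ˡ; ∈-++⁺ʳ; ∈-allFin; ∈-cartesianProduct⁺; ∈-cartesianProductWith⁺)
open import Data.List.Relation.Unary.Any using (here; there)
open import Data.Maybe using (Maybe; just; nothing) renaming (map to mapᴹ)
open import Data.Maybe.Relation.Unary.All using (All; just; nothing)
open import Data.Nat using (ℕ; zero; suc; _+_; _≤_; _<_; z≤n; s≤s)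
import Data.Nat.Properties as ℕ
open import Data.Product using (Σ; ∃-syntax; _×_; _,_; proj₁; proj₂)
open import Data.Sum using (_⊎_; inj₁; inj₂)
open import Data.Sum.Relation.Binary.Pointwise using (inj₁; inj₂)
open import Data.Vec using (Vec; []; _∷_; lookup; replicate; zipWith; _[_]≔_; sum) renaming (map to mapⱽ)
open import Data.Vec.Properties
  using (lookup-zipWith; lookup-replicate; lookup-map; lookup∘update; lookup∘update′;
         map-replicate; zipWith-assoc; zipWith-comm; zipWith-identityˡ)
open import Data.Vec.Relation.Binary.Pointwise.Extensional using (ext; Pointwise-≡⇒≡)
open import Function using (_∘_; flip)
open import Function.Bundles using (_⇔_; mk⇔)
open import Relation.Binary.Core using (Rel)
open import Relation.Binary.Construct.Closure.ReflexiveTransitive using (Star; ε; _◅_; _◅◅_; gmap)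
open import Relation.Binary.Construct.Closure.Transitive using (TransClosure; [_]; _∷_)
open import Relation.Binary.PropositionalEquality
  using (_≡_; _≢_; refl; sym; trans; cong; cong₂; subst; module ≡-Reasoning)
open import Relation.Nullary using (¬_; yes; no)
open import Defs
open Bag

-- A control that asks the bag for a datum before each transition does not work: the datum received,
-- or the test passed, commits it to some of the enabled transitions, so this communication is not
-- inert, and giving the datum back to try another would allow an infinite silent loop. Insertions
-- pose a second problem: a transition may insert many data in one step, whereas the bag accepts one
-- at a time. Both are met by letting transitions act on the control's own memory, which a bound on
-- the insertions keeps finite. Divergence preservation as defined constrains only paths related
-- throughout to a single state. Along a path in a composite of two relations the intermediate
-- states vary, so the condition for the second relation cannot be invoked directly. Excluded middle
-- enters to obtain the stronger condition, and to decide whether an infinite silent path contains a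
-- communication.

module _ {X : Set} {_∼_ : Rel X 0ℓ} where

  ◅⁺ : ∀ {x y z} → x ∼ y → Star _∼_ y z → TransClosure _∼_ x z
  ◅⁺ r ε        = [ r ]
  ◅⁺ r (q ◅ qs) = r ∷ ◅⁺ q qs

  uncons⁺ : ∀ {x z} → TransClosure _∼_ x z → ∃[ y ] (x ∼ y × Star _∼_ y z)
  uncons⁺ [ r ]    = _ , r , ε
  uncons⁺ (r ∷ rs) with _ , q , qs ← uncons⁺ rs = _ , r , q ◅ qs

  _++*_ : ∀ {x y z} → TransClosure _∼_ x y → Star _∼_ y z → TransClosure _∼_ x z
  [ r ]    ++* qs = ◅⁺ r qs
  (r ∷ rs) ++* qs = r ∷ (rs ++* qs)

  _*++_ : ∀ {x y z} → Star _∼_ x y → TransClosure _∼_ y z → TransClosure _∼_ x z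
  ε        *++ qs = qs
  (r ◅ rs) *++ qs = r ∷ (rs *++ qs)

gmap⁺ : {X Y : Set} {P : Rel X 0ℓ} {Q : Rel Y 0ℓ} (f : X → Y) →
        (∀ {x y} → P x y → Q (f x) (f y)) →
        ∀ {x y} → TransClosure P x y → TransClosure Q (f x) (f y)
gmap⁺ f g [ r ]    = [ g r ]
gmap⁺ f g (r ∷ rs) = g r ∷ gmap⁺ f g rs

-- Divergence-preserving branching bisimilarity as a pair of simulations.

module _ {A : Set} where

  -- Unlike divergence preservation, `progress` does not ask the whole path to
  -- be related to t.  This makes it closed under relational composition.
  record Simulation (G H : LTS A) (R : LTS.State G → LTS.State H → Set) : Set where
    private
      module G = LTS G
      module H = LTS H
    field
      transfer : ∀ {s t a s′} → R s t → s G.—[ a ]→ s′ →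
                 ∃[ t″ ] ∃[ t′ ] (t H.⇒ t″ × t″ H.—[⦅ a ⦆]→ t′ × R s t″ × R s′ t′)
      accept   : ∀ {s t} → R s t → s G.↓ → ∃[ t′ ] (t H.⇒ t′ × t′ H.↓)
      progress : ∀ (s : ℕ → G.State) {t} →
                 (∀ k → s k G.—τ→ s (suc k)) → R (s 0) t →
                 ∃[ t′ ] (t H.⇒⁺ t′ × ∃[ k ] R (s k) t′)

    transferτ : ∀ {s t s′} → R s t → s G.—τ→ s′ → ∃[ t′ ] (t H.⇒ t′ × R s′ t′)
    transferτ r st with transfer r st
    ... | _ , _ , ts , inj₁ u , _ , r′          = _ , ts ◅◅ u ◅ ε , r′
    ... | _ , _ , ts , inj₂ (_ , refl) , _ , r′ = _ , ts , r′

    follow : ∀ {s t s′} → R s t → s G.⇒ s′ → ∃[ t′ ] (t H.⇒ t′ × R s′ t′)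
    follow r ε = _ , ε , r
    follow r (st ◅ sts) with _ , ts , r₁ ← transferτ r st
                        with _ , us , r₂ ← follow r₁ sts = _ , ts ◅◅ us , r₂

  open Simulation

  -- For `progress`, repeated use of `RS` turns the infinite path of `G` into an infinite path of
  -- `H`, to which `SS` applies.
  compose : ∀ {G H K : LTS A} {R S} → Simulation G H R → Simulation H K S →
            Simulation G K (λ s u → ∃[ t ] (R s t × S t u))
  compose {G} {H} {K} {R} {S} RS SS = record
    { transfer = transfer′
    ; accept   = λ (_ , r , q) f →
        let _ , ts , g  = accept RS r f
            _ , us , q′ = follow SS q ts
            _ , vs , h  = accept SS q′ g
        in _ , us ◅◅ vs , h
    ; progress = progress′
    }
    where
    module G = LTS G
    module H = LTS H
    module K = LTS K

    transfer′ : ∀ {s u a s′} → (∃[ t ] (R s t × S t u)) → s G.—[ a ]→ s′ →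
      ∃[ u″ ] ∃[ u′ ] (u K.⇒ u″ × u″ K.—[⦅ a ⦆]→ u′ ×
        (∃[ t ] (R s t × S t u″)) × (∃[ t ] (R s′ t × S t u′)))
    transfer′ (_ , r , q) st with transfer RS r st
    ... | _ , _ , ts , inj₂ (refl , refl) , r″ , r′ with follow SS q ts
    ...   | _ , us , q′ = _ , _ , us , inj₂ (refl , refl) , (_ , r″ , q′) , (_ , r′ , q′)
    transfer′ (_ , r , q) st | _ , _ , ts , inj₁ tt , r″ , r′ with follow SS q ts
    ... | _ , us , q₁ with transfer SS q₁ tt
    ...   | _ , _ , vs , w , q″ , q′ =
            _ , _ , us ◅◅ vs , w , (_ , r″ , q″) , (_ , r′ , q′)

    progress′ : ∀ (s : ℕ → G.State) {u} → (∀ k → s k G.—τ→ s (suc k)) →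
      (∃[ t ] (R (s 0) t × S t u)) →
      ∃[ u′ ] (u K.⇒⁺ u′ × ∃[ k ] ∃[ t ] (R (s k) t × S t u′))
    progress′ s steps (t₀ , r₀ , q₀) =
      let _ , us , k , q = progress SS (proj₁ ∘ path) (proj₁ ∘ proj₂ ∘ next ∘ path) q₀
          -- `SS` may stop inside a segment of the path of `H`, at a state not known to be related
          -- to any state of `s`; following the rest of the segment reaches one that is.
          _ , k′ , ts , r = proj₂ (path k)
          _ , us′ , q′ = follow SS q ts
      in _ , us ++* us′ , k′ , _ , r , q′
      where
      -- The moves still owed before the path of `H` meets a state related to some `s k`.
      Ahead : H.State → Set
      Ahead t = ∃[ t′ ] ∃[ k ] (t H.⇒ t′ × R (s k) t′)

      next : ((t , _) : Σ H.State Ahead) → ∃[ t′ ] (t H.—τ→ t′ × Ahead t′)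
      next (_ , _ , k , tt ◅ ts , r) = _ , tt , _ , k , ts , r
      -- With no move left, `progress` on the tail of `s` from index `k` supplies a new segment,
      -- which is nonempty.
      next (_ , _ , k , ε , r)
        with _ , ts , k′ , r′ ← progress RS (λ j → s (j + k)) (λ j → steps (j + k)) r
        with _ , tt , ts′ ← uncons⁺ ts = _ , tt , _ , k′ + k , ts′ , r′

      path : ℕ → Σ H.State Ahead
      path zero    = t₀ , _ , 0 , ε , r₀
      path (suc k) = let t′ , _ , ahead = next (path k) in t′ , ahead

  infix 4 _≃_

  record _≃_ (G H : ProcessGraph A) : Set₁ where
    constructor bisimilar
    private
      module G = ProcessGraph G
      module H = ProcessGraph H
    field
      {Related} : G.State → H.State → Set
      forth     : Simulation G.lts H.lts Related
      back      : Simulation H.lts G.lts (flip Related)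
      roots     : Related G.root H.root

  ≃-sym : ∀ {G H} → G ≃ H → H ≃ G
  ≃-sym (bisimilar f b r) = bisimilar b f r

  weaken : ∀ {G H : LTS A} {R S} → (∀ {s t} → R s t → S s t) → (∀ {s t} → S s t → R s t) →
           Simulation G H R → Simulation G H S
  weaken f g sim = record
    { transfer = λ r st → let _ , _ , ts , u , r″ , r′ = transfer sim (g r) st
                          in _ , _ , ts , u , f r″ , f r′
    ; accept   = λ r → accept sim (g r)
    ; progress = λ s steps r → let _ , ts , k , r′ = progress sim s steps (g r)
                               in _ , ts , k , f r′
    }

  ≃-trans : ∀ {G H K} → G ≃ H → H ≃ K → G ≃ K
  ≃-trans (bisimilar f b r) (bisimilar f′ b′ r′) = bisimilar (compose f f′)
    (weaken (λ (t , p , p′) → t , p′ , p) (λ (t , p , p′) → t , p′ , p) (compose b′ b))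
    (_ , r , r′)

  record StrongSimulation (G H : LTS A) (R : LTS.State G → LTS.State H → Set) : Set where
    private
      module G = LTS G
      module H = LTS H
    field
      match       : ∀ {s t a s′} → R s t → s G.—[ a ]→ s′ → ∃[ t′ ] (t H.—[ a ]→ t′ × R s′ t′)
      match-final : ∀ {s t} → R s t → s G.↓ → t H.↓

  strong⇒simulation : ∀ {G H R} → StrongSimulation G H R → Simulation G H R
  strong⇒simulation sim = record
    { transfer = λ r st → let _ , u , r′ = match r st in _ , _ , ε , inj₁ u , r , r′
    ; accept   = λ r f → _ , ε , match-final r f
    ; progress = λ s steps r → let _ , u , r′ = match r (steps 0) in _ , [ u ] , 1 , r′
    }
    where open StrongSimulation sim

  strong⇒≃ : ∀ {G H : ProcessGraph A} (let module G = ProcessGraph G) (let module H = ProcessGraph H)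
             (R : G.State → H.State → Set) →
             StrongSimulation G.lts H.lts R → StrongSimulation H.lts G.lts (flip R) →
             R G.root H.root → G ≃ H
  strong⇒≃ R f b = bisimilar (strong⇒simulation f) (strong⇒simulation b)

  ≃-refl : ∀ {G} → G ≃ G
  ≃-refl = strong⇒≃ _≡_
    (record { match = λ { refl st → _ , st , refl } ; match-final = λ { refl f → f } })
    (record { match = λ { refl st → _ , st , refl } ; match-final = λ { refl f → f } })
    refl

  -- Serves to restrict a relation on a disjoint union to its components: a run that starts in a
  -- component stays there, so answers found in the union are answers in the component.
  record Embedding (G U : LTS A) (f : LTS.State G → LTS.State U) : Set where
    private
      module G = LTS G
      module U = LTS U
    field
      step    : ∀ {s a s′} → s G.—[ a ]→ s′ → f s U.—[ a ]→ f s′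
      unstep  : ∀ {s a u} → f s U.—[ a ]→ u → ∃[ s′ ] (u ≡ f s′ × s G.—[ a ]→ s′)
      final   : ∀ {s} → s G.↓ → f s U.↓
      unfinal : ∀ {s} → f s U.↓ → s G.↓

    unstep* : ∀ {s u} → f s U.⇒ u → ∃[ s′ ] (u ≡ f s′ × s G.⇒ s′)
    unstep* ε = _ , refl , ε
    unstep* (u ◅ us) with _ , refl , st ← unstep u
                     with _ , refl , sts ← unstep* us = _ , refl , st ◅ sts

    unstep⁺ : ∀ {s u} → f s U.⇒⁺ u → ∃[ s′ ] (u ≡ f s′ × s G.⇒⁺ s′)
    unstep⁺ us with _ , u , us′ ← uncons⁺ us
               with _ , refl , st ← unstep u
               with _ , refl , sts ← unstep* us′ = _ , refl , ◅⁺ st sts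

  inj₁-embedding : ∀ {G H : LTS A} → Embedding G (G ⊎ᴸ H) inj₁
  inj₁-embedding = record
    { step    = inj₁
    ; unstep  = λ { (inj₁ st) → _ , refl , st }
    ; final   = λ f → f
    ; unfinal = λ f → f
    }

  inj₂-embedding : ∀ {G H : LTS A} → Embedding H (G ⊎ᴸ H) inj₂
  inj₂-embedding = record
    { step    = inj₂
    ; unstep  = λ { (inj₂ st) → _ , refl , st }
    ; final   = λ f → f
    ; unfinal = λ f → f
    }

  module _ (em : ExcludedMiddle 0ℓ) where

    -- A path from s that makes no progress on the side of t is related to t
    -- throughout, so that divergence preservation applies to it.
    bisimulation⇒simulation :
      ∀ {G H U : LTS A} {f g R} → Embedding G U f → Embedding H U g →
      IsBranchingBisimulation U R → DivergencePreserving U R →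
      Simulation G H (λ s t → R (f s) (g t))
    bisimulation⇒simulation {G} {H} {U} {f} {g} {R} ef eg bis dp = record
      { transfer = transfer′
      ; accept   = accept′
      ; progress = progress′
      }
      where
      module G = LTS G
      module H = LTS H
      module U = LTS U
      module ef = Embedding ef
      module eg = Embedding eg
      module bis = IsBranchingBisimulation bis

      transfer′ : ∀ {s t a s′} → R (f s) (g t) → s G.—[ a ]→ s′ →
        ∃[ t″ ] ∃[ t′ ] (t H.⇒ t″ × t″ H.—[⦅ a ⦆]→ t′ × R (f s) (g t″) × R (f s′) (g t′))
      transfer′ r st with bis.transfer r (ef.step st)
      ... | _ , _ , us , v , r″ , r′ with eg.unstep* us | v
      ...   | _ , refl , ts | inj₂ (refl , refl) = _ , _ , ts , inj₂ (refl , refl) , r″ , r′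
      ...   | _ , refl , ts | inj₁ u with eg.unstep u
      ...     | _ , refl , tt = _ , _ , ts , inj₁ tt , r″ , r′

      accept′ : ∀ {s t} → R (f s) (g t) → s G.↓ → ∃[ t′ ] (t H.⇒ t′ × t′ H.↓)
      accept′ r fin with bis.accept r (ef.final fin)
      ... | _ , us , fin′ with eg.unstep* us
      ...   | _ , refl , ts = _ , ts , eg.unfinal fin′

      progress′ : ∀ (s : ℕ → G.State) {t} → (∀ k → s k G.—τ→ s (suc k)) → R (f (s 0)) (g t) →
        ∃[ t′ ] (t H.⇒⁺ t′ × ∃[ k ] R (f (s k)) (g t′))
      progress′ s {t} steps r
        with em {∃[ t′ ] (t H.⇒⁺ t′ × ∃[ k ] R (f (s k)) (g t′))}
      ... | yes done = done
      ... | no stuck = ⊥-elim (stuck diverging)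
        where
        related : ∀ k → R (f (s k)) (g t)
        related zero    = r
        related (suc k) with transfer′ (related k) (steps k)
        ... | _ , _ , ε      , inj₂ (_ , refl) , _ , r′ = r′
        ... | _ , _ , v ◅ vs , inj₂ (_ , refl) , _ , r′ = ⊥-elim (stuck (_ , ◅⁺ v vs , _ , r′))
        ... | _ , _ , vs     , inj₁ v          , _ , r′ = ⊥-elim (stuck (_ , vs *++ [ v ] , _ , r′))

        diverging : ∃[ t′ ] (t H.⇒⁺ t′ × ∃[ k ] R (f (s k)) (g t′))
        diverging with dp (f ∘ s) (ef.step ∘ steps) related
        ... | _ , us , k , r′ with eg.unstep⁺ us
        ...   | _ , refl , ts = _ , ts , k , r′

    ≈⇒≃ : {G H : ProcessGraph A} → G ≈ H → G ≃ H
    ≈⇒≃ (R , bis , dp , r) = bisimilar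
      (bisimulation⇒simulation inj₁-embedding inj₂-embedding bis dp)
      (weaken symmetric symmetric
        (bisimulation⇒simulation inj₂-embedding inj₁-embedding bis dp))
      r
      where open IsBranchingBisimulation bis

  -- From two simulations to a bisimulation on the disjoint union.

  module _ {G H : LTS A} {R : LTS.State G → LTS.State H → Set}
           (forth : Simulation G H R) (back : Simulation H G (flip R)) where
    private
      module G = LTS G
      module H = LTS H
      module U = LTS (G ⊎ᴸ H)

    data SymmetricSum : Rel (G.State ⊎ H.State) 0ℓ where
      fwd : ∀ {s t} → R s t → SymmetricSum (inj₁ s) (inj₂ t)
      bwd : ∀ {s t} → R s t → SymmetricSum (inj₂ t) (inj₁ s)

    symmetricSum-bisimulation : IsBranchingBisimulation (G ⊎ᴸ H) SymmetricSum
    symmetricSum-bisimulation = record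
      { symmetric = λ { (fwd r) → bwd r ; (bwd r) → fwd r }
      ; transfer  = transfer′
      ; accept    = λ
        { (fwd r) f → let _ , ts , f′ = accept forth r f in _ , gmap inj₂ inj₂ ts , f′
        ; (bwd r) f → let _ , ss , f′ = accept back r f in _ , gmap inj₁ inj₁ ss , f′
        }
      }
      where
      transfer′ : ∀ {s t a s′} → SymmetricSum s t → s U.—[ a ]→ s′ →
        ∃[ t″ ] ∃[ t′ ] (t U.⇒ t″ × t″ U.—[⦅ a ⦆]→ t′ × SymmetricSum s t″ × SymmetricSum s′ t′)
      transfer′ (fwd r) (inj₁ st) with transfer forth r st
      ... | _ , _ , ts , inj₁ u , r″ , r′ =
            _ , _ , gmap inj₂ inj₂ ts , inj₁ (inj₂ u) , fwd r″ , fwd r′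
      ... | _ , _ , ts , inj₂ (refl , refl) , r″ , r′ =
            _ , _ , gmap inj₂ inj₂ ts , inj₂ (refl , refl) , fwd r″ , fwd r′
      transfer′ (bwd r) (inj₂ st) with transfer back r st
      ... | _ , _ , ts , inj₁ u , r″ , r′ =
            _ , _ , gmap inj₁ inj₁ ts , inj₁ (inj₁ u) , bwd r″ , bwd r′
      ... | _ , _ , ts , inj₂ (refl , refl) , r″ , r′ =
            _ , _ , gmap inj₁ inj₁ ts , inj₂ (refl , refl) , bwd r″ , bwd r′

    -- `SymmetricSum` relates only states of different components, so the state `t` fixes the
    -- component in which the whole path lies; `progress` then needs only the first of the given
    -- relations.
    symmetricSum-divergence : DivergencePreserving (G ⊎ᴸ H) SymmetricSum
    symmetricSum-divergence s {inj₂ t} steps related =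
      let t′ , ts , k , r = progress forth (proj₁ ∘ left) left-step (proj₂ (proj₂ (left 0)))
      in _ , gmap⁺ inj₂ inj₂ ts , k ,
         subst (λ x → SymmetricSum x (inj₂ t′)) (sym (proj₁ (proj₂ (left k)))) (fwd r)
      where
      unfwd : ∀ {x} → SymmetricSum x (inj₂ t) → ∃[ y ] (x ≡ inj₁ y × R y t)
      unfwd (fwd r) = _ , refl , r

      left : ∀ k → ∃[ y ] (s k ≡ inj₁ y × R y t)
      left k = unfwd (related k)

      left-step : ∀ k → proj₁ (left k) G.—τ→ proj₁ (left (suc k))
      left-step k with s k | s (suc k) | left k | left (suc k) | steps k
      ... | _ | _ | _ , refl , _ | _ , refl , _ | inj₁ st = st
    symmetricSum-divergence s {inj₁ t} steps related =
      let t′ , ts , k , r = progress back (proj₁ ∘ right) right-step (proj₂ (proj₂ (right 0)))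
      in _ , gmap⁺ inj₁ inj₁ ts , k ,
         subst (λ x → SymmetricSum x (inj₁ t′)) (sym (proj₁ (proj₂ (right k)))) (bwd r)
      where
      unbwd : ∀ {x} → SymmetricSum x (inj₁ t) → ∃[ y ] (x ≡ inj₂ y × R t y)
      unbwd (bwd r) = _ , refl , r

      right : ∀ k → ∃[ y ] (s k ≡ inj₂ y × R t y)
      right k = unbwd (related k)

      right-step : ∀ k → proj₁ (right k) H.—τ→ proj₁ (right (suc k))
      right-step k with s k | s (suc k) | right k | right (suc k) | steps k
      ... | _ | _ | _ , refl , _ | _ , refl , _ | inj₂ st = st

  ≃⇒≈ : {G H : ProcessGraph A} → G ≃ H → G ≈ H
  ≃⇒≈ (bisimilar f b r) =
    SymmetricSum f b , symmetricSum-bisimulation f b , symmetricSum-divergence f b , fwd r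

-- Multisets as vectors of multiplicities.

module _ {n : ℕ} where

  bag-ext : {x y : Bag n} → (∀ e → lookup x e ≡ lookup y e) → x ≡ y
  bag-ext eq = Pointwise-≡⇒≡ (ext eq)

  lookup-∪ : ∀ e (x y : Bag n) → lookup (x ∪ y) e ≡ lookup x e + lookup y e
  lookup-∪ = lookup-zipWith _+_

  lookup-insert : ∀ d (x : Bag n) → lookup (⁅ d ⁆ ∪ x) d ≡ suc (lookup x d)
  lookup-insert d x = trans (lookup-∪ d ⁅ d ⁆ x) (cong (_+ lookup x d) (lookup∘update d ∅ 1))

  lookup-insert′ : ∀ {d e} → e ≢ d → (x : Bag n) → lookup (⁅ d ⁆ ∪ x) e ≡ lookup x e
  lookup-insert′ {d} {e} e≢d x = trans (lookup-∪ e ⁅ d ⁆ x)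
    (cong (_+ _) (trans (lookup∘update′ e≢d ∅ 1) (lookup-replicate e 0)))

  ∪-identityˡ : (x : Bag n) → ∅ ∪ x ≡ x
  ∪-identityˡ = zipWith-identityˡ ℕ.+-identityˡ

  insert-comm : ∀ d e (x : Bag n) → ⁅ d ⁆ ∪ ⁅ e ⁆ ∪ x ≡ ⁅ e ⁆ ∪ ⁅ d ⁆ ∪ x
  insert-comm d e x = begin
    ⁅ d ⁆ ∪ ⁅ e ⁆ ∪ x   ≡⟨ zipWith-assoc ℕ.+-assoc ⁅ d ⁆ ⁅ e ⁆ x ⟨
    (⁅ d ⁆ ∪ ⁅ e ⁆) ∪ x ≡⟨ cong (_∪ x) (zipWith-comm ℕ.+-comm ⁅ d ⁆ ⁅ e ⁆) ⟩
    (⁅ e ⁆ ∪ ⁅ d ⁆) ∪ x ≡⟨ zipWith-assoc ℕ.+-assoc ⁅ e ⁆ ⁅ d ⁆ x ⟩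
    ⁅ e ⁆ ∪ ⁅ d ⁆ ∪ x   ∎
    where open ≡-Reasoning

  insert-cancel : ∀ d {x y : Bag n} → ⁅ d ⁆ ∪ x ≡ ⁅ d ⁆ ∪ y → x ≡ y
  insert-cancel d {x} {y} eq = bag-ext λ e → ℕ.+-cancelˡ-≡ (lookup ⁅ d ⁆ e) _ _
    (trans (sym (lookup-∪ e ⁅ d ⁆ x)) (trans (cong (λ z → lookup z e) eq) (lookup-∪ e ⁅ d ⁆ y)))

  extract : ∀ {d m} (x : Bag n) → lookup x d ≡ suc m → ∃[ y ] x ≡ ⁅ d ⁆ ∪ y
  extract {d} {m} x eq = x [ d ]≔ m , bag-ext pointwise
    where
    pointwise : ∀ e → lookup x e ≡ lookup (⁅ d ⁆ ∪ (x [ d ]≔ m)) e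
    pointwise e with e ≟ d
    ... | yes refl = trans eq (sym (trans (lookup-insert d (x [ d ]≔ m))
                                          (cong suc (lookup∘update d x m))))
    ... | no e≢d   = sym (trans (lookup-insert′ e≢d (x [ d ]≔ m)) (lookup∘update′ e≢d x m))

  -- As `e` differs from `d`, the copy of `e` on the right must come from `x`; taking it out and
  -- cancelling it on both sides determines `y`.
  insert-split : ∀ {d e} {x y : Bag n} → e ≢ d → ⁅ d ⁆ ∪ x ≡ ⁅ e ⁆ ∪ y →
                 ∃[ z ] (x ≡ ⁅ e ⁆ ∪ z × y ≡ ⁅ d ⁆ ∪ z)
  insert-split {d} {e} {x} {y} e≢d eq
    with z , refl ← extract x (trans (sym (lookup-insert′ e≢d x))
                                (trans (cong (λ z → lookup z e) eq) (lookup-insert e y)))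
    = z , refl , insert-cancel e (trans (sym eq) (insert-comm d e z))

-- Extension of the action alphabet.

module _ {A : Set} (D : Set) where

  Extend-injective : ∀ {a a′ : Label A} {b : Label (Action A D)} →
                     Extend a b → Extend a′ b → a ≡ a′
  Extend-injective τ   τ   = refl
  Extend-injective act act = refl

  Extend-total : (a : Label A) → ∃[ b ] Extend {D = D} a b
  Extend-total τ       = _ , τ
  Extend-total (act _) = _ , act

  extend-simulation : ∀ {G H : ProcessGraph A} {R} →
    Simulation (ProcessGraph.lts G) (ProcessGraph.lts H) R →
    Simulation (ProcessGraph.lts (extend D G)) (ProcessGraph.lts (extend D H)) R
  extend-simulation {G} {H} {R} sim = record
    { transfer = transfer′
    ; accept   = λ r f → let _ , ts , f′ = accept r f in _ , gmap _ (λ u → τ , τ , u) ts , f′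
    ; progress = λ s steps r →
        let _ , ts , k , r′ = progress s (unτ ∘ steps) r in _ , gmap⁺ _ (λ u → τ , τ , u) ts , k , r′
    }
    where
    open Simulation sim
    module G′ = ProcessGraph (extend D G)
    module H′ = ProcessGraph (extend D H)

    unτ : ∀ {s s′} → s G′.—[ τ ]→ s′ → ProcessGraph._—τ→_ G s s′
    unτ (_ , τ , st) = st

    transfer′ : ∀ {s t b s′} → R s t → s G′.—[ b ]→ s′ →
      ∃[ t″ ] ∃[ t′ ] (t H′.⇒ t″ × t″ H′.—[⦅ b ⦆]→ t′ × R s t″ × R s′ t′)
    transfer′ r (_ , e , st) with transfer r st | e
    ... | _ , _ , ts , inj₁ u , r″ , r′             | e =
          _ , _ , gmap _ (λ u → τ , τ , u) ts , inj₁ (_ , e , u) , r″ , r′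
    ... | _ , _ , ts , inj₂ (refl , refl) , r″ , r′ | τ =
          _ , _ , gmap _ (λ u → τ , τ , u) ts , inj₂ (refl , refl) , r″ , r′

  -- Each label has an extension, and the extension determines the label, so an answer in the
  -- extended graph carries the original label.
  unextend-simulation : ∀ {G H : ProcessGraph A} {R} →
    Simulation (ProcessGraph.lts (extend D G)) (ProcessGraph.lts (extend D H)) R →
    Simulation (ProcessGraph.lts G) (ProcessGraph.lts H) R
  unextend-simulation {G} {H} {R} sim = record
    { transfer = transfer′
    ; accept   = λ r f → let _ , ts , f′ = accept r f in _ , gmap _ unτ ts , f′
    ; progress = λ s steps r →
        let _ , ts , k , r′ = progress s (λ k → _ , τ , steps k) r in _ , gmap⁺ _ unτ ts , k , r′
    }
    where
    open Simulation sim
    module G = ProcessGraph G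
    module H = ProcessGraph H
    module H′ = ProcessGraph (extend D H)

    unτ : ∀ {s s′} → s H′.—[ τ ]→ s′ → s H.—τ→ s′
    unτ (_ , τ , st) = st

    transfer′ : ∀ {s t a s′} → R s t → s G.—[ a ]→ s′ →
      ∃[ t″ ] ∃[ t′ ] (t H.⇒ t″ × t″ H.—[⦅ a ⦆]→ t′ × R s t″ × R s′ t′)
    transfer′ {a = a} r st with _ , e ← Extend-total a with transfer r (_ , e , st) | e
    ... | _ , _ , ts , inj₁ (_ , e′ , u) , r″ , r′ | e with refl ← Extend-injective e′ e =
          _ , _ , gmap _ unτ ts , inj₁ u , r″ , r′
    transfer′ r st | _ , _ , ts , inj₂ (refl , refl) , r″ , r′ | τ =
          _ , _ , gmap _ unτ ts , inj₂ (refl , refl) , r″ , r′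

  extend-cong : ∀ {G H : ProcessGraph A} → G ≃ H → extend D G ≃ extend D H
  extend-cong {G} {H} (bisimilar f b r) =
    bisimilar (extend-simulation {G} {H} f) (extend-simulation {H} {G} b) r

  extend-reflect : ∀ {G H : ProcessGraph A} → extend D G ≃ extend D H → G ≃ H
  extend-reflect {G} {H} (bisimilar f b r) =
    bisimilar (unextend-simulation {G} {H} f) (unextend-simulation {H} {G} b) r

-- Processes running on a multiset.

module _ {A : Set} {n : ℕ} where

  -- What an action of a process does in τ_{i,o}(∂_{i,o}(_ ∥ ABag^io)): the
  -- action that is observed and the change of the contents of the bag.
  data Effect : Label (Action A (Fin n)) → Label A → Bag n → Bag n → Set where
    silent   : ∀ {x} → Effect τ τ x x
    external : ∀ {a x} → Effect (act (ext a)) (act a) x x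
    internal : ∀ {c v x} → Effect (act (c ⟪ v ⟫)) τ x x
    insert   : ∀ {d x y} → y ≡ ⁅ d ⁆ ∪ x → Effect (act (i ! d)) τ x y
    remove   : ∀ {d x y} → x ≡ ⁅ d ⁆ ∪ y → Effect (act (o ⁇ (⁺ d))) τ x y
    test     : ∀ {d x} → d ∉ᴮ x → Effect (act (o ⁇ (⁻ d))) τ x x

  -- The actions `i ⁇ d` and `o ! v` of `q` have no `Effect` and so are blocked: encapsulation
  -- forbids them alone, and the bag offers no partner for them. Acceptance ignores the contents
  -- because the bag always accepts.
  bagged : ProcessGraph (Action A (Fin n)) → ProcessGraph A
  bagged q = record
    { lts  = record
      { State   = State × Bag n
      ; _—[_]→_ = λ (s , x) a (t , y) → ∃[ b ] (s —[ b ]→ t × Effect b a x y)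
      ; _↓      = λ (s , _) → s ↓
      }
    ; root = root , ∅
    }
    where open ProcessGraph q

  module _ (em : ExcludedMiddle 0ℓ) where

    -- A silent path of `bagged F` need not be a silent path of `F`. If one of its steps is visible
    -- in `F`, then that step cannot be answered by staying put, which gives progress. Otherwise the
    -- contents never change, and `progress` for `F` applies.
    bagged-simulation : ∀ {F G : ProcessGraph (Action A (Fin n))} {R} →
      Simulation (ProcessGraph.lts F) (ProcessGraph.lts G) R →
      Simulation (ProcessGraph.lts (bagged F)) (ProcessGraph.lts (bagged G))
        (λ (s , x) (t , y) → R s t × x ≡ y)
    bagged-simulation {F} {G} {R} sim = record
      { transfer = transfer′
      ; accept   = λ { (r , refl) f → let _ , ts , f′ = accept r f in _ , lift ts , f′ }
      ; progress = progress′
      }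
      where
      open Simulation sim
      module F = ProcessGraph F
      module G = ProcessGraph G
      module F′ = ProcessGraph (bagged F)
      module G′ = ProcessGraph (bagged G)

      R′ : F′.State → G′.State → Set
      R′ (s , x) (t , y) = R s t × x ≡ y

      lift : ∀ {t t′ x} → t G.⇒ t′ → (t , x) G′.⇒ (t′ , x)
      lift = gmap _ (λ u → _ , u , silent)

      transfer′ : ∀ {s t a s′} → R′ s t → s F′.—[ a ]→ s′ →
        ∃[ t″ ] ∃[ t′ ] (t G′.⇒ t″ × t″ G′.—[⦅ a ⦆]→ t′ × R′ s t″ × R′ s′ t′)
      transfer′ (r , refl) (b , st , e) with transfer r st | e
      ... | _ , _ , ts , inj₁ u , r″ , r′ | e =
            _ , _ , lift ts , inj₁ (b , u , e) , (r″ , refl) , (r′ , refl)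
      ... | _ , _ , ts , inj₂ (refl , refl) , r″ , r′ | silent =
            _ , _ , lift ts , inj₂ (refl , refl) , (r″ , refl) , (r′ , refl)

      followτ : ∀ {s t s′} → R′ s t → s F′.—τ→ s′ → ∃[ t′ ] (t G′.⇒ t′ × R′ s′ t′)
      followτ r st with transfer′ r st
      ... | _ , _ , ts , inj₁ u , _ , r′          = _ , ts ◅◅ u ◅ ε , r′
      ... | _ , _ , ts , inj₂ (_ , refl) , _ , r′ = _ , ts , r′

      progress′ : ∀ (s : ℕ → F′.State) {t} → (∀ k → s k F′.—τ→ s (suc k)) → R′ (s 0) t →
        ∃[ t′ ] (t G′.⇒⁺ t′ × ∃[ k ] R′ (s k) t′)
      progress′ s {t} steps r@(r₀ , refl)
        with em {∃[ k ] ¬ (proj₁ (steps k) ≡ τ)}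
      ... | yes (k , noisy) = conclude (steps k) noisy (reach k)
        where
        reach : ∀ k → ∃[ t′ ] (t G′.⇒ t′ × R′ (s k) t′)
        reach zero    = t , ε , r
        reach (suc k) = let _ , ts , r₁ = reach k
                            _ , us , r₂ = followτ r₁ (steps k)
                        in _ , ts ◅◅ us , r₂

        conclude : ((b , _) : s k F′.—τ→ s (suc k)) → ¬ (b ≡ τ) →
          ∃[ t′ ] (t G′.⇒ t′ × R′ (s k) t′) → ∃[ t′ ] (t G′.⇒⁺ t′ × ∃[ k ] R′ (s k) t′)
        conclude (b , st , e) noisy (_ , ts , q , refl) with transfer q st
        ... | _ , _ , us , inj₂ (refl , _) , _ , _ = ⊥-elim (noisy refl)
        ... | _ , _ , us , inj₁ u , _ , q′ =
              _ , ts *++ (lift us *++ [ b , u , e ]) , suc k , (q′ , refl)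
      ... | no quiet =
            let _ , ts , k , r′ = progress (proj₁ ∘ s) (proj₁ ∘ own) r₀
            in _ , gmap⁺ _ (λ u → _ , u , silent) ts , k , r′ , constant k
        where
        own-step : ∀ {u v} (st : u F′.—τ→ v) → proj₁ st ≡ τ →
                   proj₁ u F.—τ→ proj₁ v × proj₂ v ≡ proj₂ u
        own-step (_ , st , silent) refl = st , refl

        own : ∀ k → proj₁ (s k) F.—τ→ proj₁ (s (suc k)) × proj₂ (s (suc k)) ≡ proj₂ (s k)
        own k with em {proj₁ (steps k) ≡ τ}
        ... | yes eq   = own-step (steps k) eq
        ... | no noisy = ⊥-elim (quiet (k , noisy))

        constant : ∀ k → proj₂ (s k) ≡ proj₂ (s 0)
        constant zero    = refl
        constant (suc k) = trans (proj₂ (own k)) (constant k)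

    bagged-cong : ∀ {F G} → F ≃ G → bagged F ≃ bagged G
    bagged-cong {F} {G} (bisimilar f b r) = bisimilar
      (bagged-simulation {F} {G} f)
      (weaken (λ (r , eq) → r , sym eq) (λ (r , eq) → r , sym eq) (bagged-simulation {G} {F} b))
      (r , refl)

-- The always accepting bag as a multiset.

module _ {A : Set} {n : ℕ} (q : ProcessGraph (Action A (Fin n))) where
  private
    module q = ProcessGraph q
    module b = ProcessGraph (extend (Fin n) (bagged q))
  open Process q.lts
  open LTS terms

  -- Each insertion happens at the innermost `ABag` and wraps it in a new layer. A layer that has
  -- handed out its datum remains as a spent one, so many terms represent the same bag.
  data Contains : Term → Bag n → Set where
    empty : Contains ABag ∅
    full  : ∀ {B x} d → Contains B x →
            Contains (θ (B ∥ (𝟏 ⊕ act (o ! (⁺ d)) · 𝟏))) (⁅ d ⁆ ∪ x)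
    spent : ∀ {B x} → Contains B x → Contains (θ (B ∥ 𝟏)) x

  data Serve : Act → Bag n → Bag n → Set where
    receive : ∀ {d x y} → y ≡ ⁅ d ⁆ ∪ x → Serve (act (i ⁇ d)) x y
    give    : ∀ {d x y} → x ≡ ⁅ d ⁆ ∪ y → Serve (act (o ! (⁺ d))) x y
    deny    : ∀ {d x} → d ∉ᴮ x → Serve (act (o ! (⁻ d))) x x

  Contains-accepts : ∀ {B x} → Contains B x → B ↓
  Contains-accepts empty      = inj₁ (inj₁ _)
  Contains-accepts (full d c) = Contains-accepts c , inj₁ _
  Contains-accepts (spent c)  = Contains-accepts c , _

  -- Layers never communicate with each other: the inner term receives on `i` only, and the cell
  -- beside it can only send on `o`.
  serve-sound : ∀ {B x a B′} → Contains B x → B —[ a ]→ B′ →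
                ∃[ x′ ] (Serve a x x′ × Contains B′ x′)
  serve-sound empty (left (right (summand d prefix))) = _ , receive refl , full d empty
  serve-sound empty (right (summand d prefix)) = _ , deny (lookup-replicate d 0) , empty
  serve-sound (full d c) (priority (left st) top) with serve-sound c st
  ... | _ , receive refl , c′ = _ , receive (insert-comm d _ _) , full d c′
  ... | _ , give refl , c′    = _ , give (insert-comm d _ _) , full d c′
  ... | _ , deny {d = e} e∉ , c′ with e ≟ d
  -- The layer's own `o ! (⁺ d)` outranks the denial of `d` coming from inside, so `θ` suppresses
  -- the latter.
  ...   | yes refl = ⊥-elim (top _ absent≺present (_ , right (right prefix)))
  ...   | no e≢d   = _ , deny (trans (lookup-insert′ e≢d _) e∉) , full d c′
  serve-sound (full d c) (priority (right (left ())) _)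
  serve-sound (full d c) (priority (right (right prefix)) _) = _ , give refl , spent c
  serve-sound (full d c) (priority (syncˡ _ (left ())) _)
  serve-sound (full d c) (priority (syncˡ _ (right ())) _)
  serve-sound (full d c) (priority (syncʳ _ (left ())) _)
  serve-sound (full d c) (priority (syncʳ st (right prefix)) _) with serve-sound c st
  ... | _ , () , _
  serve-sound (spent c) (priority (left st) _) with serve-sound c st
  ... | _ , s , c′ = _ , s , spent c′
  serve-sound (spent c) (priority (right ()) _)
  serve-sound (spent c) (priority (syncˡ _ ()) _)
  serve-sound (spent c) (priority (syncʳ _ ()) _)

  -- A step of `p` above the denial is labelled `o ! (⁺ d)` or `τ`. Nothing outranks these, so it
  -- would survive as a step of `θ p`; by soundness the bag has no silent step and gives only what
  -- it contains.
  deny-maximal : ∀ {p d x} → Contains (θ p) x → d ∉ᴮ x →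
                 ∀ b → act (o ! (⁻ d)) ≺ b → ¬ (∃[ p′ ] p —[ b ]→ p′)
  deny-maximal c d∉ _ absent≺present (_ , st) with serve-sound c (priority st λ _ ())
  ... | _ , give {d} {y = y} refl , _ with () ← trans (sym (lookup-insert d y)) d∉
  deny-maximal c d∉ _ absent≺τ (_ , st) with serve-sound c (priority st λ _ ())
  ... | _ , () , _

  serve-complete : ∀ {B x a x′} → Contains B x → Serve a x x′ →
                   ∃[ B′ ] (B —[ a ]→ B′ × Contains B′ x′)
  serve-complete empty (receive refl) = _ , left (right (summand _ prefix)) , full _ empty
  serve-complete empty (give {d} {y = y} eq)
    with () ← trans (sym (lookup-insert d y))
                (trans (sym (cong (λ z → lookup z d) eq)) (lookup-replicate d 0))
  serve-complete empty (deny _) = _ , right (summand _ prefix) , empty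
  serve-complete (full d c) (receive refl) with serve-complete c (receive refl)
  ... | _ , st , c′ =
        _ , priority (left st) (λ _ ()) , subst (Contains _) (insert-comm d _ _) (full d c′)
  serve-complete (full d c) (give {e} eq) with e ≟ d
  ... | yes refl with refl ← insert-cancel d eq = _ , priority (right (right prefix)) (λ _ ()) , spent c
  ... | no e≢d with _ , refl , refl ← insert-split e≢d eq
               with _ , st , c′ ← serve-complete c (give refl) =
                 _ , priority (left st) (λ _ ()) , full d c′
  serve-complete (full d c) (deny {e} e∉) with e ≟ d
  ... | yes refl with () ← trans (sym (lookup-insert d _)) e∉
  ... | no e≢d with _ , st , c′ ← serve-complete c (deny (trans (sym (lookup-insert′ e≢d _)) e∉)) =
                 _ , priority (left st) (deny-maximal (full d c) e∉) , full d c′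
  serve-complete (spent c) (deny e∉) with serve-complete c (deny e∉)
  ... | _ , st , c′ = _ , priority (left st) (deny-maximal (spent c) e∉) , spent c′
  serve-complete (spent c) (receive eq) with serve-complete c (receive eq)
  ... | _ , st , c′ = _ , priority (left st) (λ _ ()) , spent c′
  serve-complete (spent c) (give eq) with serve-complete c (give eq)
  ... | _ , st , c′ = _ , priority (left st) (λ _ ()) , spent c′

  private
    io : List Port
    io = i ∷ o ∷ []

    ∈io : ∀ c → c ∈ io
    ∈io i = here refl
    ∈io o = there (here refl)

  data Represents : Term → b.State → Set where
    represents : ∀ {s B x} → Contains B x →
                 Represents (τ⟨ io ⟩ (∂⟨ io ⟩ (state s ∥ B))) (s , x)

  represents-sound : StrongSimulation terms b.lts Represents
  represents-sound = record
    { match       = match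
    ; match-final = λ { (represents _) (f , _) → f }
    }
    where
    match : ∀ {p u a p′} → Represents p u → p —[ a ]→ p′ → ∃[ u′ ] (u b.—[ a ]→ u′ × Represents p′ u′)
    match (represents c) (hide _ (encapsulate (left (constant st)) _)) =
      _ , (_ , τ , _ , st , internal) , represents c
    match (represents c) (hide _ (encapsulate (right st) _)) with serve-sound c st
    ... | _ , () , _
    match (represents c) (hide _ (encapsulate (syncˡ (constant st) st′) _)) with serve-sound c st′
    ... | _ , receive eq , c′ = _ , (_ , τ , _ , st , insert eq) , represents c′
    match (represents c) (hide _ (encapsulate (syncʳ (constant st) st′) _)) with serve-sound c st′
    ... | _ , give eq , c′ = _ , (_ , τ , _ , st , remove eq) , represents c′
    ... | _ , deny d∉ , c′ = _ , (_ , τ , _ , st , test d∉) , represents c′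
    match {a = τ} (represents c) (keep (encapsulate (left (constant st)) _) _) =
      _ , (_ , τ , _ , st , silent) , represents c
    match {a = act (ext _)} (represents c) (keep (encapsulate (left (constant st)) _) _) =
      _ , (_ , act , _ , st , external) , represents c
    match {a = act (c ! _)} (represents _) (keep (encapsulate _ ¬com) _) = ⊥-elim (¬com (send (∈io c)))
    match {a = act (c ⁇ _)} (represents _) (keep (encapsulate _ ¬com) _) = ⊥-elim (¬com (receive (∈io c)))
    match {a = act (c ⟪ _ ⟫)} (represents _) (keep _ visible) = ⊥-elim (visible (comm (∈io c)))
    match {a = τ} (represents c) (keep (encapsulate (right st) _) _) with serve-sound c st
    ... | _ , () , _
    match {a = act (ext _)} (represents c) (keep (encapsulate (right st) _) _) with serve-sound c st
    ... | _ , () , _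

  represents-complete : StrongSimulation b.lts terms (flip Represents)
  represents-complete = record
    { match       = match
    ; match-final = λ { (represents c) f → f , Contains-accepts c }
    }
    where
    match : ∀ {u p a u′} → Represents p u → u b.—[ a ]→ u′ → ∃[ p′ ] (p —[ a ]→ p′ × Represents p′ u′)
    match (represents c) (_ , τ , _ , st , silent) =
      _ , keep (encapsulate (left (constant st)) λ ()) (λ ()) , represents c
    match (represents c) (_ , act , _ , st , external) =
      _ , keep (encapsulate (left (constant st)) λ ()) (λ ()) , represents c
    match (represents c) (_ , τ , _ , st , internal) =
      _ , hide (∈io _) (encapsulate (left (constant st)) λ ()) , represents c
    match (represents c) (_ , τ , _ , st , insert eq) with serve-complete c (receive eq)
    ... | _ , st′ , c′ =
      _ , hide (∈io i) (encapsulate (syncˡ (constant st) st′) λ ()) , represents c′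
    match (represents c) (_ , τ , _ , st , remove eq) with serve-complete c (give eq)
    ... | _ , st′ , c′ =
      _ , hide (∈io o) (encapsulate (syncʳ (constant st) st′) λ ()) , represents c′
    match (represents c) (_ , τ , _ , st , test d∉) with serve-complete c (deny d∉)
    ... | _ , st′ , c′ =
      _ , hide (∈io o) (encapsulate (syncʳ (constant st) st′) λ ()) , represents c′

  withABag≃bagged : q withABag ≃ extend (Fin n) (bagged q)
  withABag≃bagged =
    strong⇒≃ Represents represents-sound represents-complete (represents empty)

-- From finite automata to parallel pushdown automata.

data Guard {n : ℕ} : Signed (Fin n) → Bag n → Bag n → Set where
  present : ∀ {d x y} → x ≡ ⁅ d ⁆ ∪ y → Guard (⁺ d) x y
  absent  : ∀ {d x} → d ∉ᴮ x → Guard (⁻ d) x x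

module _ {A : Set} (M : ParallelPushdownAutomaton A) where
  open ParallelPushdownAutomaton M

  -- The indices of `Step` contain applications of `∪`, which obstruct pattern matching on a given
  -- bag; here they become equations, and the test is separated from the insertion.
  Firing : State × Bag #data → Label A → State × Bag #data → Set
  Firing (s , x) a (t , y) =
    ∃[ δ ] ∃[ z ] ∃[ w ] (transition (s , a , δ , z , t) × Guard δ x w × y ≡ z ∪ w)

  step⇒firing : ∀ {u a v} → Step M u a v → Firing u a v
  step⇒firing (present x tr)   = _ , _ , _ , tr , present refl , refl
  step⇒firing (absent x d∉ tr) = _ , _ , _ , tr , absent d∉ , refl

  firing⇒step : ∀ {u a v} → Firing u a v → Step M u a v
  firing⇒step (_ , _ , _ , tr , present refl , refl) = present _ tr
  firing⇒step (_ , _ , _ , tr , absent d∉ , refl)    = absent _ d∉ tr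

module _ {A : Set} {n : ℕ} (F : ProcessGraph (Action A (Fin n))) (finite : IsFiniteAutomaton F) where
  private
    module F = ProcessGraph F
  open IsFiniteAutomaton finite

  Instruction : Set
  Instruction = Label A × Signed (Fin (suc n)) × Bag (suc n)

  -- The datum zero never enters the bag, so that ⁻ zero is a void condition.
  instructions : Label (Action A (Fin n)) → List Instruction
  instructions τ                 = (τ , ⁻ zero , ∅) ∷ []
  instructions (act (ext a))     = (act a , ⁻ zero , ∅) ∷ []
  instructions (act (c ⟪ v ⟫))   = (τ , ⁻ zero , ∅) ∷ []
  instructions (act (i ! d))     = (τ , ⁻ zero , ⁅ suc d ⁆) ∷ []
  instructions (act (o ⁇ (⁺ d))) = (τ , ⁺ suc d , ∅) ∷ []
  instructions (act (o ⁇ (⁻ d))) = (τ , ⁻ suc d , ∅) ∷ []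
  instructions _                 = []

  observed : Label (Action A (Fin n)) → List A
  observed (act (ext a)) = a ∷ []
  observed _             = []

  visible-instruction : ∀ {a δ x} b → (act a , δ , x) ∈ instructions b → b ≡ act (ext a)
  visible-instruction τ (here ())
  visible-instruction (act (ext a)) (here refl) = refl
  visible-instruction (act (c ⟪ v ⟫)) (here ())
  visible-instruction (act (i ! d)) (here ())
  visible-instruction (act (o ⁇ (⁺ d))) (here ())
  visible-instruction (act (o ⁇ (⁻ d))) (here ())

  -- A transition of a parallel pushdown automaton has to test some datum, whence the extra one in
  -- `suc n` for the unconditional steps. As `A` may be infinite, `alphabet` keeps only the visible
  -- actions that occur in `F`.
  compile : ParallelPushdownAutomaton A
  compile = record
    { State              = F.State
    ; alphabet           = λ a → ∃[ s ] ∃[ t ] (s F.—[ act (ext a) ]→ t)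
    ; #data              = suc n
    ; transition         = λ (s , a , δ , x , t) → ∃[ b ] (s F.—[ b ]→ t × (a , δ , x) ∈ instructions b)
    ; initial            = F.root
    ; accepting          = F._↓
    ; finite-states      = finite-states
    ; finite-alphabet    = _ , λ (_ , _ , st) →
        ∈-concatMap⁺ (λ (_ , b , _) → observed b) (lose (proj₂ finite-transitions st) (here refl))
    ; finite-transitions = _ , λ (b , st , m) →
        ∈-concatMap⁺ (λ (s , b , t) → map (λ (a , δ , x) → s , a , δ , x , t) (instructions b))
          (lose (proj₂ finite-transitions st) (∈-map⁺ _ m))
    ; labels             = λ (b , st , m) → _ , _ , subst (λ b → _ F.—[ b ]→ _) (visible-instruction b m) st
    }

  data Padded : F.State × Bag n → F.State × Bag (suc n) → Set where
    padded : ∀ {s x} → Padded (s , x) (s , 0 ∷ x)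

  private
    module b = ProcessGraph (bagged F)
    module P = ProcessGraph (𝓟 compile)

  unchanged : (x : Bag (suc n)) → x ≡ ∅ ∪ x
  unchanged x = sym (∪-identityˡ x)

  compile-sound : StrongSimulation b.lts P.lts Padded
  compile-sound = record
    { match       = λ r st → let _ , f , r′ = match r st in _ , firing⇒step compile f , r′
    ; match-final = λ { padded f → f }
    }
    where
    match : ∀ {u v a u′} → Padded u v → u b.—[ a ]→ u′ → ∃[ v′ ] (Firing compile v a v′ × Padded u′ v′)
    match padded (b , st , silent) =
      _ , (_ , _ , _ , (b , st , here refl) , absent refl , unchanged _) , padded
    match padded (b , st , external) =
      _ , (_ , _ , _ , (b , st , here refl) , absent refl , unchanged _) , padded
    match padded (b , st , internal) =
      _ , (_ , _ , _ , (b , st , here refl) , absent refl , unchanged _) , padded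
    match padded (b , st , insert refl) =
      _ , (_ , _ , _ , (b , st , here refl) , absent refl , refl) , padded
    match padded (b , st , remove refl) =
      _ , (_ , _ , _ , (b , st , here refl) , present refl , unchanged _) , padded
    match padded (b , st , test d∉) =
      _ , (_ , _ , _ , (b , st , here refl) , absent d∉ , unchanged _) , padded

  compile-complete : StrongSimulation P.lts b.lts (flip Padded)
  compile-complete = record
    { match       = λ r st → match r (step⇒firing compile st)
    ; match-final = λ { padded f → f }
    }
    where
    pad : ∀ {s x y} → y ≡ ∅ ∪ (0 ∷ x) → Padded (s , x) (s , y)
    pad {x = x} refl = subst (λ z → Padded (_ , x) (_ , 0 ∷ z)) (sym (∪-identityˡ x)) padded

    uncons : ∀ {d : Fin n} {x y} → (0 ∷ x) ≡ ⁅ suc d ⁆ ∪ y → ∃[ z ] (y ≡ 0 ∷ z × x ≡ ⁅ d ⁆ ∪ z)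
    uncons {y = _ ∷ _} refl = _ , refl , refl

    match : ∀ {u v a v′} → Padded u v → Firing compile v a v′ → ∃[ u′ ] (u b.—[ a ]→ u′ × Padded u′ v′)
    match padded (_ , _ , _ , (τ , st , here refl) , absent _ , eq) =
      _ , (τ , st , silent) , pad eq
    match padded (_ , _ , _ , (act (ext a) , st , here refl) , absent _ , eq) =
      _ , (act (ext a) , st , external) , pad eq
    match padded (_ , _ , _ , (act (c ⟪ v ⟫) , st , here refl) , absent _ , eq) =
      _ , (act (c ⟪ v ⟫) , st , internal) , pad eq
    match padded (_ , _ , _ , (act (i ! d) , st , here refl) , absent _ , refl) =
      _ , (act (i ! d) , st , insert refl) , padded
    match padded (_ , _ , _ , (act (o ⁇ (⁺ d)) , st , here refl) , present eq′ , eq)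
      with _ , refl , refl ← uncons eq′ = _ , (act (o ⁇ (⁺ d)) , st , remove refl) , pad eq
    match padded (_ , _ , _ , (act (o ⁇ (⁻ d)) , st , here refl) , absent d∉ , eq) =
      _ , (act (o ⁇ (⁻ d)) , st , test d∉) , pad eq

  bagged≃compile : bagged F ≃ 𝓟 compile
  bagged≃compile = strong⇒≃ Padded compile-sound compile-complete padded

-- Division of a multiset between the control and the bag.

lookup≤sum : ∀ {n} (x : Vec ℕ n) e → lookup x e ≤ sum x
lookup≤sum (m ∷ x) zero    = ℕ.m≤m+n m (sum x)
lookup≤sum (m ∷ x) (suc e) = ℕ.≤-trans (lookup≤sum x e) (ℕ.m≤n+m (sum x) m)

vectors : ∀ {X : Set} → List X → (n : ℕ) → List (Vec X n)
vectors xs zero    = [] ∷ []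
vectors xs (suc n) = cartesianProductWith _∷_ xs (vectors xs n)

∈-vectors : ∀ {X : Set} {xs : List X} → (∀ x → x ∈ xs) → ∀ {n} (v : Vec X n) → v ∈ vectors xs n
∈-vectors all []      = here refl
∈-vectors all (x ∷ v) = ∈-cartesianProductWith⁺ _∷_ (all x) (∈-vectors all v)

-- The finite control holds some copies of each datum, the bag the others, or
-- it knows that there are none at all.
Holding : Set
Holding = Maybe ℕ

pattern none   = nothing
pattern held k = just k

-- `m` counts the copies in the bag and `t` those in the bag of the simulated automaton. Unlike
-- `none`, `held 0` leaves open whether the bag contains the datum.
data Totals : Holding → ℕ → ℕ → Set where
  absent : ∀ {m t} → m ≡ 0 → t ≡ 0 → Totals none m t
  stored : ∀ {k m t} → t ≡ k + m → Totals (held k) m t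

-- Inserted data enter the control's memory first, so that a firing remains a single step. Gaining
-- zero copies turns `none` into `held 0`; the forgotten absence is rediscovered by `missing`.
gain : ℕ → Holding → Holding
gain m none     = held m
gain m (held k) = held (m + k)

gain-totals : ∀ m {h y t} → Totals h y t → Totals (gain m h) y (m + t)
gain-totals m (absent refl refl) = stored refl
gain-totals m (stored refl)    = stored (sym (ℕ.+-assoc m _ _))

-- The number of communications needed to reach `held 1` or `none`; the sum over all data is the
-- termination measure. `held 0` needs one, whether the datum is found or not.
slack : Holding → ℕ
slack none           = 0
slack (held 0)       = 1
slack (held (suc k)) = k

total-slack : ∀ {n} → Vec Holding n → ℕ
total-slack = sum ∘ mapⱽ slack

total-slack-update : ∀ {n h′} (w : Vec Holding n) d → slack (lookup w d) ≡ suc (slack h′) →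
                     total-slack w ≡ suc (total-slack (w [ d ]≔ h′))
total-slack-update (h ∷ w) zero eq    = cong (_+ total-slack w) eq
total-slack-update (h ∷ w) (suc d) eq =
  trans (cong (slack h +_) (total-slack-update w d eq)) (ℕ.+-suc (slack h) _)

Tidied : ∀ {n} → Vec Holding n → Set
Tidied w = ∀ e → slack (lookup w e) ≡ 0

data Tidying {A : Set} {n : ℕ} (d : Fin n) : Holding → Action A (Fin n) → Holding → Set where
  surplus : ∀ {k} → Tidying d (held (2 + k)) (i ! d) (held (1 + k))
  found   : Tidying d (held 0) (o ⁇ (⁺ d)) (held 1)
  missing : Tidying d (held 0) (o ⁇ (⁻ d)) none

tidying-slack : ∀ {A n d h α h′} → Tidying {A} {n} d h α h′ → slack h ≡ suc (slack h′)
tidying-slack surplus = refl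
tidying-slack found   = refl
tidying-slack missing = refl

data Fetch {n : ℕ} : Signed (Fin n) → Vec Holding n → Vec Holding n → Set where
  present : ∀ {d w} → lookup w d ≡ held 1 → Fetch (⁺ d) w (w [ d ]≔ held 0)
  absent  : ∀ {d w} → lookup w d ≡ none → Fetch (⁻ d) w w

Extend-effect : ∀ {A n a a′ b x y} → Extend {A} {Fin n} a b → Effect b a′ x y → a ≡ a′ × x ≡ y
Extend-effect τ   silent   = refl , refl
Extend-effect act external = refl , refl

module _ {n : ℕ} where

  record Splits (w : Vec Holding n) (y t : Bag n) : Set where
    constructor splits
    field
      at : ∀ e → Totals (lookup w e) (lookup y e) (lookup t e)

  open Splits public

  totals-at : ∀ {w y t d h} → Splits w y t → lookup w d ≡ h → Totals h (lookup y d) (lookup t d)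
  totals-at {d = d} sp refl = at sp d

  update-splits : ∀ {w y y′ t t′ d h} → Splits w y t → Totals h (lookup y′ d) (lookup t′ d) →
    (∀ {e} → e ≢ d → lookup y′ e ≡ lookup y e) → (∀ {e} → e ≢ d → lookup t′ e ≡ lookup t e) →
    Splits (w [ d ]≔ h) y′ t′
  update-splits {w} {y} {y′} {t} {t′} {d} {h} sp totals ys ts = splits pointwise
    where
    pointwise : ∀ e → Totals (lookup (w [ d ]≔ h) e) (lookup y′ e) (lookup t′ e)
    pointwise e with e ≟ d
    ... | yes refl rewrite lookup∘update d w h = totals
    ... | no e≢d   rewrite lookup∘update′ e≢d w h | ys e≢d | ts e≢d = at sp e

  gain-splits : ∀ x {w y t} → Splits w y t → Splits (zipWith gain x w) y (x ∪ t)
  gain-splits x {w} {y} {t} sp = splits pointwise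
    where
    pointwise : ∀ e → Totals (lookup (zipWith gain x w) e) (lookup y e) (lookup (x ∪ t) e)
    pointwise e rewrite lookup-zipWith gain e x w | lookup-∪ e x t =
      gain-totals (lookup x e) (at sp e)

  -- A copy moves between control and bag, or its absence is noticed; either way the simulated
  -- contents `t` stay the same.
  tidying-inert : ∀ {A w y y′ t d h α h′ a} → Splits w y t → lookup w d ≡ h → Tidying {A} d h α h′ →
                  Effect (act α) a y y′ → a ≡ τ × Splits (w [ d ]≔ h′) y′ t
  tidying-inert {y = y} {d = d} sp eq (surplus {k}) (insert refl) with totals-at sp eq
  ... | stored eq′ = refl , update-splits sp
        (stored (trans eq′ (sym (trans (cong (suc k +_) (lookup-insert d y)) (ℕ.+-suc (suc k) _)))))
        (λ e≢d → lookup-insert′ e≢d y) (λ _ → refl)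
  tidying-inert {y′ = y′} {d = d} sp eq found (remove refl) with totals-at sp eq
  ... | stored eq′ = refl , update-splits sp
        (stored (trans eq′ (lookup-insert d y′))) (λ e≢d → sym (lookup-insert′ e≢d y′)) (λ _ → refl)
  tidying-inert sp eq missing (test d∉) with totals-at sp eq
  ... | stored eq′ = refl , update-splits sp (absent d∉ (trans eq′ d∉)) (λ _ → refl) (λ _ → refl)

  tidying-enabled : ∀ {A} d h (y : Bag n) → slack h ≢ 0 →
    ∃[ α ] ∃[ h′ ] ∃[ y′ ] (Tidying {A} d h α h′ × Effect (act α) τ y y′)
  tidying-enabled d none y slack≢0             = ⊥-elim (slack≢0 refl)
  tidying-enabled d (held 1) y slack≢0         = ⊥-elim (slack≢0 refl)
  tidying-enabled d (held (suc (suc k))) y _   = _ , _ , _ , surplus , insert refl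
  tidying-enabled d (held 0) y _ with lookup y d in eq
  ... | zero  = _ , _ , _ , missing , test eq
  ... | suc _ = _ , _ , _ , found , remove (proj₂ (extract y eq))

  fetch-splits : ∀ {w y t d} → lookup w d ≡ held 1 → Splits w y (⁅ d ⁆ ∪ t) → Splits (w [ d ]≔ held 0) y t
  fetch-splits {t = t} {d} eq sp with totals-at sp eq
  ... | stored eq′ = update-splits sp
        (stored (ℕ.suc-injective (trans (sym (lookup-insert d t)) eq′)))
        (λ _ → refl) (λ e≢d → sym (lookup-insert′ e≢d t))

  fetch⇒guard : ∀ {δ w v y t} → Splits w y t → Fetch δ w v → ∃[ t′ ] (Guard δ t t′ × Splits v y t′)
  fetch⇒guard {t = t} sp (present eq) with totals-at sp eq
  ... | stored eq′ with t′ , refl ← extract t eq′ = t′ , present refl , fetch-splits eq sp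
  fetch⇒guard sp (absent eq) with totals-at sp eq
  ... | absent _ d∉ = _ , absent d∉ , sp

  -- A tidied entry is `none` or `held 1`, and this decides whether the datum occurs in `t`;
  -- `held 0` would leave it undetermined.
  guard⇒fetch : ∀ {δ w y t t′} → Splits w y t → Tidied w → Guard δ t t′ → ∃[ v ] (Fetch δ w v × Splits v y t′)
  guard⇒fetch {w = w} {t′ = t′} sp tidied (present {d} refl) with lookup w d in eq | at sp d | tidied d
  ... | none   | absent _ t≡0 | _ with () ← trans (sym (lookup-insert d t′)) t≡0
  ... | held 1 | _            | _ = _ , present eq , fetch-splits eq sp
  guard⇒fetch {w = w} sp tidied (absent {d} d∉) with lookup w d in eq | at sp d | tidied d
  ... | none   | _          | _ = _ , absent eq , sp
  ... | held 1 | stored eq′ | _ with () ← trans (sym eq′) d∉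

-- Bounded holdings.

module _ {N n : ℕ} where

  -- States use `Fin N` so that they are finite in number, while all reasoning takes place on
  -- unbounded holdings; `encode` recovers a state once a bound is shown.
  decode : Vec (Maybe (Fin N)) n → Vec Holding n
  decode = mapⱽ (mapᴹ toℕ)

  Bounded : Vec Holding n → Set
  Bounded w = ∀ e → All (_< N) (lookup w e)

  decode-bounded : ∀ w → Bounded (decode w)
  decode-bounded w e rewrite lookup-map e (mapᴹ toℕ) w with lookup w e
  ... | nothing = nothing
  ... | just k  = just (toℕ<n k)

  update-bounded : ∀ {w d h} → Bounded w → All (_< N) h → Bounded (w [ d ]≔ h)
  update-bounded {w} {d} {h} bw bh e with e ≟ d
  ... | yes refl rewrite lookup∘update d w h      = bh
  ... | no e≢d   rewrite lookup∘update′ e≢d w h = bw e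

encode : ∀ {N n} (w : Vec Holding n) → Bounded {N} w → ∃[ v ] decode {N} v ≡ w
encode []      _ = [] , refl
encode (h ∷ w) b with encode w (b ∘ suc) | h | b zero
... | v , eq | none   | nothing = nothing ∷ v , cong (none ∷_) eq
... | v , eq | held k | just lt = just (fromℕ< lt) ∷ v , cong₂ (λ k w → held k ∷ w) (toℕ-fromℕ< lt) eq

tidying-bounded : ∀ {A n K d h α h′} → Tidying {A} {n} d h α h′ → All (_< 2 + K) h → All (_< 2 + K) h′
tidying-bounded surplus (just lt) = just (ℕ.<-trans (ℕ.n<1+n _) lt)
tidying-bounded found   _         = just (s≤s (s≤s z≤n))
tidying-bounded missing _         = nothing

tidied-≤1 : ∀ {h} → slack h ≡ 0 → All (_≤ 1) h
tidied-≤1 {none}   _    = nothing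
tidied-≤1 {held 1} refl = just ℕ.≤-refl

fetch-≤1 : ∀ {n δ} {w v : Vec Holding n} → Tidied w → Fetch δ w v → ∀ e → All (_≤ 1) (lookup v e)
fetch-≤1 tidied (absent _) e = tidied-≤1 (tidied e)
fetch-≤1 tidied (present {d} {w} _) e with e ≟ d
... | yes refl rewrite lookup∘update d w (held 0)      = just z≤n
... | no e≢d   rewrite lookup∘update′ e≢d w (held 0) = tidied-≤1 (tidied e)

gain-bounded : ∀ {K m h} → m ≤ K → All (_≤ 1) h → All (_< 2 + K) (gain m h)
gain-bounded {K} m≤K nothing = just (s≤s (ℕ.m≤n⇒m≤1+n m≤K))
gain-bounded {K} {m} m≤K (just {x = k} k≤1) =
  just (s≤s (subst (m + k ≤_) (ℕ.+-comm K 1) (ℕ.+-mono-≤ m≤K k≤1)))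

-- The finite control of a parallel pushdown automaton.

module _ {A : Set} (M : ParallelPushdownAutomaton A) where
  open ParallelPushdownAutomaton M
  private
    n : ℕ
    n = #data
    module P = ProcessGraph (𝓟 M)

  inserted : State × Label A × Signed D × Bag n × State → Bag n
  inserted (_ , _ , _ , x , _) = x

  -- A crude bound suffices: the sizes of all inserted bags, summed over the finite list of
  -- transitions.
  max-insertion : ∃[ K ] (∀ {s a δ x t} → transition (s , a , δ , x , t) → ∀ e → lookup x e ≤ K)
  max-insertion = _ , λ {x = x} tr e → ℕ.≤-trans (lookup≤sum x e) (bound (proj₂ finite-transitions tr))
    where
    sizes : List (State × Label A × Signed D × Bag n × State) → ℕ
    sizes []       = 0
    sizes (r ∷ rs) = sum (inserted r) + sizes rs

    bound : ∀ {r rs} → r ∈ rs → sum (inserted r) ≤ sizes rs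
    bound (here refl)      = ℕ.m≤m+n _ _
    bound {rs = r ∷ _} (there m) = ℕ.≤-trans (bound m) (ℕ.m≤n+m _ (sum (inserted r)))

  -- A firing starts from at most one held copy of each datum and adds at most
  -- `proj₁ max-insertion`. That sum must lie strictly below the size of `Fin capacity`, hence the
  -- 2.
  capacity : ℕ
  capacity = 2 + proj₁ max-insertion

  -- The automaton first restores the state where it holds exactly one copy
  -- of each datum that is present.  Only then does it know which transitions
  -- are enabled, and commit to one of them.
  data Move : State × Vec Holding n → Label (Action A D) → State × Vec Holding n → Set where
    tidy : ∀ {s w d h α h′ v} → lookup w d ≡ h → Tidying d h α h′ → v ≡ w [ d ]≔ h′ →
           Move (s , w) (act α) (s , v)
    fire : ∀ {s w a b δ x t v v′} → Tidied w → transition (s , a , δ , x , t) → Extend a b →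
           Fetch δ w v → v′ ≡ zipWith gain x v → Move (s , w) b (t , v′)

  control : ProcessGraph (Action A D)
  control = record
    { lts  = record
      { State   = State × Vec (Maybe (Fin capacity)) n
      ; _—[_]→_ = λ (s , w) b (t , v) → Move (s , decode w) b (t , decode v)
      ; _↓      = λ (s , _) → accepting s
      }
    ; root = initial , replicate n nothing
    }

  control-finite : IsFiniteAutomaton control
  control-finite = record
    { finite-states      = states , λ _ → ∈-states _
    ; finite-transitions = cartesianProduct states (cartesianProduct labels′ states) , λ st →
        ∈-cartesianProduct⁺ (∈-states _) (∈-cartesianProduct⁺ (∈-labels st) (∈-states _))
    }
    where
    holdings : List (Maybe (Fin capacity))
    holdings = nothing ∷ map just (allFin capacity)

    ∈-holdings : ∀ h → h ∈ holdings
    ∈-holdings nothing  = here refl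
    ∈-holdings (just k) = there (∈-map⁺ just (∈-allFin k))

    states : List (ProcessGraph.State control)
    states = cartesianProduct (proj₁ finite-states) (vectors holdings n)

    ∈-states : ∀ s → s ∈ states
    ∈-states (s , w) = ∈-cartesianProduct⁺ (proj₂ finite-states _) (∈-vectors ∈-holdings w)

    communications : D → List (Action A D)
    communications d = (i ! d) ∷ (o ⁇ (⁺ d)) ∷ (o ⁇ (⁻ d)) ∷ []

    labels′ : List (Label (Action A D))
    labels′ = τ ∷ map act (map ext (proj₁ finite-alphabet) ++ concatMap communications (allFin n))

    ∈-tidying : ∀ {d h α h′} → Tidying {A} d h α h′ → α ∈ communications d
    ∈-tidying surplus = here refl
    ∈-tidying found   = there (here refl)
    ∈-tidying missing = there (there (here refl))

    ∈-labels : ∀ {s b t} → Move s b t → b ∈ labels′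
    ∈-labels (tidy {d = d} _ ty _) =
      there (∈-map⁺ act (∈-++⁺ʳ _ (∈-concatMap⁺ communications (lose (∈-allFin d) (∈-tidying ty)))))
    ∈-labels (fire _ tr τ _ _)   = here refl
    ∈-labels (fire _ tr act _ _) =
      there (∈-map⁺ act (∈-++⁺ˡ (∈-map⁺ ext (proj₂ finite-alphabet (labels tr)))))

  private
    module Q = ProcessGraph (bagged control)

  data Implements : Q.State → P.State → Set where
    implements : ∀ {s w y t} → Splits (decode w) y t → Implements ((s , w) , y) (s , t)

  untidiness : Q.State → ℕ
  untidiness ((_ , w) , _) = total-slack (decode w)

  -- The drop of `untidiness` in the first alternative is what rules out an infinite run of tidying
  -- alone.
  explain : ∀ {u v a u′} → Implements u v → u Q.—[ a ]→ u′ →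
    (a ≡ τ × Implements u′ v × untidiness u ≡ suc (untidiness u′)) ⊎
    (∃[ v′ ] (v P.—[ a ]→ v′ × Implements u′ v′))
  explain {u = (_ , w) , y} {_ , t} {u′ = (_ , w′) , _} (implements sp) (_ , tidy {d = d} {h′ = h′} refl ty eq , e)
    with refl , sp′ ← tidying-inert sp refl ty e =
      inj₁ (refl , implements (subst (λ v → Splits v _ t) (sym eq) sp′) ,
            trans (total-slack-update {h′ = h′} (decode w) d (tidying-slack ty)) (cong (suc ∘ total-slack) (sym eq)))
  explain {u = (_ , w) , y} {_ , t} (implements sp) (_ , fire {x = x} {v = v} _ tr ex fe eq , e)
    with refl , refl ← Extend-effect ex e
    with t′ , g , sp′ ← fetch⇒guard sp fe =
      inj₂ (_ , firing⇒step M (_ , _ , _ , tr , g , refl) ,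
            implements (subst (λ v → Splits v y (x ∪ t′)) (sym eq) (gain-splits x sp′)))

  -- Since `v` stays fixed, the path can serve as the inert prefix that branching bisimulation
  -- permits. The recursion is on the measure `m`.
  tidy-up : ∀ m {u v} → untidiness u ≡ m → Implements u v →
    ∃[ w′ ] ∃[ y′ ] (u Q.⇒ ((proj₁ (proj₁ u) , w′) , y′) ×
      Implements ((proj₁ (proj₁ u) , w′) , y′) v × Tidied (decode w′))
  tidy-up m {u@((s , w) , y)} {_ , t} eq r@(implements sp)
    with all? (λ e → slack (lookup (decode w) e) ℕ.≟ 0)
  ... | yes tidied = _ , _ , ε , r , tidied
  ... | no untidy
    with d , slack≢0 ← ¬∀⟶∃¬ _ _ (λ e → slack (lookup (decode w) e) ℕ.≟ 0) untidy
    with α , h′ , y′ , ty , e ← tidying-enabled {A = A} d (lookup (decode w) d) y slack≢0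
    with w′ , dec ← encode {N = capacity} (decode w [ d ]≔ h′)
                      (update-bounded {w = decode w} (decode-bounded w)
                        (tidying-bounded ty (decode-bounded w d)))
    -- An enabled tidying move makes the untidiness a successor, which excludes `m` being zero.
    with m | trans (sym eq) (trans
                 (total-slack-update {h′ = h′} (decode w) d (tidying-slack ty))
                 (cong (suc ∘ total-slack) (sym dec)))
  ... | suc m | eq′
    with _ , sp′ ← tidying-inert sp refl ty e
    with _ , _ , us , r′ , tidied ← tidy-up m {(s , w′) , y′} (sym (ℕ.suc-injective eq′))
                                      (implements (subst (λ v → Splits v y′ t) (sym dec) sp′)) =
      _ , _ , (act α , tidy refl ty dec , e) ◅ us , r′ , tidied

  -- Tidying leads to a state that still implements `v` and knows every guard, so the matching
  -- `fire` is available there. An actual step is made in every case, which also settles `progress`.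
  answer : ∀ {v u a v′} → Implements u v → v P.—[ a ]→ v′ →
    ∃[ u″ ] ∃[ u′ ] (u Q.⇒ u″ × u″ Q.—[ a ]→ u′ × Implements u″ v × Implements u′ v′)
  answer {_ , t} {(s , w) , _} r st
    with _ , x , t′ , tr , g , refl ← step⇒firing M st
    with w₁ , y , us , r₁@(implements sp) , tidied ← tidy-up _ refl r
    with v , fe , sp′ ← guard⇒fetch sp tidied g
    with w₂ , dec ← encode {N = capacity} (zipWith gain x v) (λ e →
           subst (All (_< capacity)) (sym (lookup-zipWith gain e x v))
             (gain-bounded (proj₂ max-insertion tr e) (fetch-≤1 tidied fe e)))
    = _ , _ , us , observe {x = x} tr tidied fe dec , r₁ ,
      implements (subst (λ v → Splits v y (x ∪ t′)) (sym dec) (gain-splits x sp′))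
    where
    observe : ∀ {s a δ x t w v w′ y} → transition (s , a , δ , x , t) → Tidied (decode w) →
              Fetch δ (decode w) v → decode w′ ≡ zipWith gain x v →
              ((s , w) , y) Q.—[ a ]→ ((t , w′) , y)
    observe {a = τ}     tr tidied fe eq = τ , fire tidied tr τ fe eq , silent
    observe {a = act a} tr tidied fe eq = act (ext a) , fire tidied tr act fe eq , external

  control-sound : Simulation Q.lts P.lts Implements
  control-sound = record
    { transfer = transfer′
    ; accept   = λ { (implements _) f → _ , ε , f }
    ; progress = λ s → progress′ _ s refl
    }
    where
    transfer′ : ∀ {u v a u′} → Implements u v → u Q.—[ a ]→ u′ →
      ∃[ v″ ] ∃[ v′ ] (v P.⇒ v″ × v″ P.—[⦅ a ⦆]→ v′ × Implements u v″ × Implements u′ v′)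
    transfer′ r st with explain r st
    ... | inj₁ (refl , r′ , _) = _ , _ , ε , inj₂ (refl , refl) , r , r′
    ... | inj₂ (_ , u , r′)    = _ , _ , ε , inj₁ u , r , r′

    progress′ : ∀ m (s : ℕ → Q.State) {v} → untidiness (s 0) ≡ m → (∀ k → s k Q.—τ→ s (suc k)) →
      Implements (s 0) v → ∃[ v′ ] (v P.⇒⁺ v′ × ∃[ k ] Implements (s k) v′)
    progress′ m s eq steps r with explain r (steps 0)
    ... | inj₂ (_ , u , r′) = _ , [ u ] , 1 , r′
    ... | inj₁ (_ , r′ , decrease) with m | trans (sym eq) decrease
    ...   | suc m | eq′
            with _ , us , k , r″ ← progress′ m (s ∘ suc) (sym (ℕ.suc-injective eq′)) (steps ∘ suc) r′ =
            _ , us , suc k , r″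

  control-complete : Simulation P.lts Q.lts (flip Implements)
  control-complete = record
    { transfer = λ r st → let _ , _ , us , u , r″ , r′ = answer r st in _ , _ , us , inj₁ u , r″ , r′
    ; accept   = λ { (implements _) f → _ , ε , f }
    ; progress = λ s steps r → let _ , _ , us , u , _ , r′ = answer r (steps 0) in _ , us *++ [ u ] , 1 , r′
    }

  control≃𝓟 : bagged control ≃ 𝓟 M
  control≃𝓟 = bisimilar control-sound control-complete (implements initially)
    where
    untouched : Splits (replicate n nothing) ∅ ∅
    untouched = splits λ e → subst (λ h → Totals h (lookup ∅ e) (lookup ∅ e))
      (sym (lookup-replicate e nothing)) (absent (lookup-replicate e 0) (lookup-replicate e 0))

    initially : Splits (decode (replicate n nothing)) ∅ ∅
    initially = subst (λ w → Splits w ∅ ∅) (sym (map-replicate (mapᴹ toℕ) nothing n)) untouched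

theorem15 : ExcludedMiddle 0ℓ → (A : Set) (p : ProcessGraph A) →
    IsParallelPushdownProcess p ⇔
    (Σ ℕ λ n → Σ (ProcessGraph (Action A (Fin n))) λ q →
    Regular q × (extend (Fin n) p ≈ q withABag))
theorem15 em A p = mk⇔
  (λ (M , p≈M) → _ , control M , (control M , control-finite M , ≃⇒≈ (≃-refl {G = control M})) ,
    ≃⇒≈ (≃-trans
      (extend-cong _ (≃-trans (≈⇒≃ em {p} {𝓟 M} p≈M) (≃-sym (control≃𝓟 M))))
      (≃-sym (withABag≃bagged (control M)))))
  (λ (n , q , (F , finite , q≈F) , p≈q) → compile F finite ,
    ≃⇒≈ (≃-trans
      (extend-reflect _ (≃-trans (≈⇒≃ em {extend (Fin n) p} {q withABag} p≈q) (withABag≃bagged q)))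
      -- Finiteness is known of `F` alone, so `F` replaces `q` under `bagged` before it is compiled.
      (≃-trans (bagged-cong em (≈⇒≃ em {q} {F} q≈F)) (bagged≃compile F finite))))
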